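{- Suppose that for all positive integers $m$ and $\ell$ with $\ell\ge 2m+1$ we have $f_{C_\ell}(m,m)=m$, where $C_\ell$ is the cycle on $\ell$ vertices. Then for every positive integer $n$ and every finite graph $G$ of maximum degree at most two with $c_e(G)\le 4$ and such that $G$ has at least one independent set of size $n$, we have $f_G(n,n-1)=n-1$.
   Context: For a collection $\mathcal{F}=(F_1,\dots,F_k)$ of sets (not necessarily distinct), a rainbow set of $\mathcal{F}$ is a set $\{x_{i_1},\dots,x_{i_m}\}$ of $m$ distinct elements with $i_1<\dots<i_m$ distinct indices in $[k]$ and $x_{i_j}\in F_{i_j}$. Given a graph $G$ and a collection $\mathcal{F}$ of independent sets of $G$, a rainbow independent set of $(\mathcal{F},G)$ is a rainbow set of $\mathcal{F}$ that is also independent in $G$; an $m$-set is a set of size $m$. For integers $m\le n$, $f_G(n,m)$ is the minimal number $k$ such that every collection of $k$ (not necessarily distinct) independent $n$-sets of $G$ has a rainbow independent $m$-set. $c_e(G)$ denotes the number of connected components of $G$ that are isomorphic to cycles of even length. -}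

module Defs where

open import Data.Nat using (ℕ; zero; suc; _+_; _*_; _∸_; _≤_; _<_; _≡ᵇ_)
open import Data.Bool using (Bool; true; false; _∧_; _∨_; T)
open import Data.Fin using (Fin; toℕ)
open import Data.Fin.Subset using (Subset; _∈_; ∣_∣)
open import Data.Product using (Σ; _×_; _,_)
open import Relation.Binary.PropositionalEquality using (_≡_; _≢_)
open import Relation.Binary.Construct.Closure.ReflexiveTransitive using (Star)
open import Relation.Nullary using (¬_)
open import Data.Empty using (⊥)

record Graph : Set where
  field
    V   : ℕ
    adj : Fin V → Fin V → Bool

open Graph public

Adj : (G : Graph) → Fin (V G) → Fin (V G) → Set
Adj G u v = T (adj G u v)

IsSimple : Graph → Set
IsSimple G = (∀ u v → Adj G u v → Adj G v u) × (∀ u → ¬ Adj G u u)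

MaxDegreeAtMost2 : Graph → Set
MaxDegreeAtMost2 G = ∀ u a b c → Adj G u a → Adj G u b → Adj G u c →
  a ≢ b → a ≢ c → b ≢ c → ⊥

cycNext : (ℓ : ℕ) → Fin ℓ → Fin ℓ → Bool
cycNext ℓ i j = (suc (toℕ i) ≡ᵇ toℕ j) ∨ ((suc (toℕ i) ≡ᵇ ℓ) ∧ (toℕ j ≡ᵇ 0))

Cycle : ℕ → Graph
Cycle ℓ = record { V = ℓ ; adj = λ i j → cycNext ℓ i j ∨ cycNext ℓ j i }

Injective : {A B : Set} → (A → B) → Set
Injective f = ∀ a b → f a ≡ f b → a ≡ b

Independent : (G : Graph) → Subset (V G) → Set
Independent G S = ∀ u v → u ∈ S → v ∈ S → ¬ Adj G u v

IndepNSet : (G : Graph) → ℕ → Subset (V G) → Set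
IndepNSet G n S = Independent G S × ∣ S ∣ ≡ n

RainbowIndepSet : (G : Graph) (k : ℕ) → (Fin k → Subset (V G)) → ℕ → Set
RainbowIndepSet G k F m =
  Σ (Fin m → Fin (V G)) λ x → Σ (Fin m → Fin k) λ c →
    Injective x × Injective c × (∀ j → x j ∈ F (c j)) ×
    (∀ j j′ → ¬ Adj G (x j) (x j′))

HasRainbowProperty : (G : Graph) (n m k : ℕ) → Set
HasRainbowProperty G n m k =
  (F : Fin k → Subset (V G)) → (∀ i → IndepNSet G n (F i)) → RainbowIndepSet G k F m

fG≡ : (G : Graph) (n m k : ℕ) → Set
fG≡ G n m k = HasRainbowProperty G n m k × (∀ j → j < k → ¬ HasRainbowProperty G n m j)

Reach : (G : Graph) → Fin (V G) → Fin (V G) → Set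
Reach G = Star (Adj G)

InEvenCycleComponent : (G : Graph) → Fin (V G) → Set
InEvenCycleComponent G u =
  Σ ℕ λ t → 2 ≤ t × Σ (Fin (2 * t) → Fin (V G)) λ φ →
    Injective φ × (∀ i → Reach G u (φ i)) × (∀ v → Reach G u v → Σ (Fin (2 * t)) λ i → φ i ≡ v) ×
    (∀ i j → (Adj G (φ i) (φ j) → Adj (Cycle (2 * t)) i j) × (Adj (Cycle (2 * t)) i j → Adj G (φ i) (φ j)))

-- c_e(G) ≤ 4: there are no five vertices lying in pairwise distinct connected
-- components that are each isomorphic to an even cycle
CeAtMost4 : Graph → Set
CeAtMost4 G = ¬ (Σ (Fin 5 → Fin (V G)) λ w →
  (∀ i → InEvenCycleComponent G (w i)) × (∀ i j → i ≢ j → ¬ Reach G (w i) (w j)))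

{-# OPTIONS --safe #-}
module Submission where

-- Call the members of the family rows. A vertex with at most one neighbour can be chosen
-- greedily, so G may be taken to be a disjoint union of cycles, with k rows of size k + 1.
-- By the hypothesis, m rows meeting a cycle C in at least m vertices each have a rainbow
-- m-set in C as long as m ≤ t(C) = ⌊(|C| - 1)/2⌋, and an independent set has at most
-- t(C) + 1 vertices on C; call a row with exactly t(C) + 1 of them full on C. Then C is
-- even and a row full on C is one of the two alternating sets.
--   If more than 2 t(C) rows are full on C, then t(C) + 1 of them coincide on C; choosing
-- all of C's share from these, induct. Otherwise cap the size of each row on C at t(C). A
-- row whose capped sizes add up to less than k is full on two cycles, hence is an edge of a
-- multigraph on the cycles with degrees at most 2 t(C). An orientation with in-degrees at
-- most t(C) assigns these rows, and the others are assigned one cycle at a time, giving C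
-- the largest number m of rows that have at least m vertices on it.

open import Defs
open import Algebra.Bundles using (CommutativeMonoid)
open import Data.Bool using (Bool; true; false; T; if_then_else_)
import Data.Bool.Properties as Bool
open import Data.Bool.Properties using (T?; T-≡; T-∨; T-∧)
open import Data.Empty using (⊥; ⊥-elim)
open import Data.Fin using (Fin; zero; suc; toℕ; fromℕ<; inject₁; fromℕ)
import Data.Fin.Properties as Fin
import Data.Fin.Subset.Properties as SubsetP
open import Data.Fin.Subset as Subset using (Subset; ∣_∣; inside; outside)
open import Data.List using (List; []; _∷_; _++_; map; length; concat; lookup; tabulate; allFin; take; drop)
open import Data.List.Membership.Propositional using (_∈_; _∉_; find; lose)
open import Data.List.Membership.Propositional.Properties
  using (∈-lookup; ∈-∃++; ∈-concat⁺; ∈-concat⁻; ∈-allFin; ∈-++⁺ˡ; ∈-++⁺ʳ; ∈-++⁻)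
open import Data.List.Relation.Binary.Disjoint.Propositional using (Disjoint)
import Data.List.Relation.Binary.Disjoint.Propositional.Properties as Disjoint
open import Data.List.Relation.Binary.Permutation.Propositional
  using (_↭_; refl; prep; swap; trans; ↭-sym; ↭-reflexive)
import Data.List.Relation.Binary.Permutation.Propositional.Properties as Perm
open import Data.List.Relation.Binary.Pointwise using (Pointwise; []; _∷_)
open import Data.List.Relation.Binary.Subset.Propositional using (_⊆_)
open import Data.List.Relation.Unary.All using (All; []; _∷_)
import Data.List.Relation.Unary.All as All
import Data.List.Relation.Unary.All.Properties as All
open import Data.List.Relation.Unary.AllPairs using (AllPairs; []; _∷_)
import Data.List.Relation.Unary.AllPairs as AllPairs
import Data.List.Relation.Unary.AllPairs.Properties as AllPairs
open import Data.List.Relation.Unary.Any using (here; there; any?; index)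
open import Data.List.Relation.Unary.Any.Properties using (lookup-index)
open import Data.List.Relation.Unary.Unique.Propositional using (Unique)
import Data.List.Relation.Unary.Unique.Propositional.Properties as Unique
import Data.List.Properties as List
open import Data.Nat
open import Data.Nat.ListAction using (sum)
open import Data.Nat.ListAction.Properties using (sum-++; sum-↭)
open import Data.Nat.Properties
open import Data.Nat.Tactic.RingSolver using (solve-∀)
open import Data.Product using (∃; ∃₂; Σ; _×_; _,_; proj₁; proj₂; uncurry)
open import Data.Sum using (_⊎_; inj₁; inj₂)
import Data.Sum as Sum
import Data.Vec as Vec
import Data.Vec.Properties as Vec
open import Function using (_∘_; _on_; case_of_)
open import Function.Bundles using (Equivalence)
open import Relation.Binary.Definitions using (DecidableEquality)
open import Relation.Binary.PropositionalEquality
  using (_≡_; _≢_; refl; sym; cong; cong₂; subst; subst₂; module ≡-Reasoning)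
  renaming (trans to ≡-trans)
open import Relation.Nullary
open import Relation.Nullary.Decidable using (_⊎-dec_; _×-dec_; ¬?; decidable-stable)
open import Relation.Unary using (Decidable)

private variable
  A B : Set

-- Sums over lists

∑ : (A → ℕ) → List A → ℕ
∑ f xs = sum (map f xs)

𝟙 : {P : Set} → Dec P → ℕ
𝟙 d = if does d then 1 else 0

𝟙-yes : {P : Set} (d : Dec P) → P → 𝟙 d ≡ 1
𝟙-yes (yes _) p = refl
𝟙-yes (no ¬p) p = contradiction p ¬p

𝟙-no : {P : Set} (d : Dec P) → ¬ P → 𝟙 d ≡ 0
𝟙-no (yes p) ¬p = contradiction p ¬p
𝟙-no (no _)  ¬p = refl

∑-++ : (f : A → ℕ) (xs ys : List A) → ∑ f (xs ++ ys) ≡ ∑ f xs + ∑ f ys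
∑-++ f xs ys rewrite List.map-++ f xs ys = sum-++ (map f xs) (map f ys)

∑-↭ : (f : A → ℕ) {xs ys : List A} → xs ↭ ys → ∑ f xs ≡ ∑ f ys
∑-↭ f p = sum-↭ (Perm.map⁺ f p)

∑-mono : {f g : A → ℕ} {xs : List A} → All (λ x → f x ≤ g x) xs → ∑ f xs ≤ ∑ g xs
∑-mono []       = z≤n
∑-mono (p ∷ ps) = +-mono-≤ p (∑-mono ps)

∑-+ : (f g : A → ℕ) (xs : List A) → ∑ (λ x → f x + g x) xs ≡ ∑ f xs + ∑ g xs
∑-+ f g []       = refl
∑-+ f g (x ∷ xs) rewrite ∑-+ f g xs = lemma (f x) (g x) (∑ f xs) (∑ g xs)
  where
  lemma : ∀ a b c d → (a + b) + (c + d) ≡ (a + c) + (b + d)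
  lemma = solve-∀

∑-one : {f : A → ℕ} {xs : List A} → All (λ x → f x ≡ 1) xs → ∑ f xs ≡ length xs
∑-one []       = refl
∑-one (p ∷ ps) = cong₂ _+_ p (∑-one ps)

∈⇒↭∷ : {x : A} {xs : List A} → x ∈ xs → ∃ λ ys → xs ↭ x ∷ ys
∈⇒↭∷ {x = x} x∈xs with ys , zs , refl ← ∈-∃++ x∈xs = ys ++ zs , Perm.shift x ys zs

separate : {P : A → Set} (P? : Decidable P) (xs : List A) →
  ∃₂ λ ys zs → xs ↭ ys ++ zs × All P ys × All (¬_ ∘ P) zs
separate P? [] = [] , [] , refl , [] , []
separate P? (x ∷ xs) with separate P? xs | P? x
... | ys , zs , xs↭ , pys , pzs | yes px = x ∷ ys , zs , prep x xs↭ , px ∷ pys , pzs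
... | ys , zs , xs↭ , pys , pzs | no ¬px =
  ys , x ∷ zs , trans (prep x xs↭) (↭-sym (Perm.shift x ys zs)) , pys , ¬px ∷ pzs

pick : {P : A → Set} (P? : Decidable P) {xs : List A} →
  (∃₂ λ x ys → xs ↭ x ∷ ys × P x) ⊎ All (¬_ ∘ P) xs
pick P? {xs} with any? P? xs
... | no ¬any = inj₂ (All.¬Any⇒All¬ xs ¬any)
... | yes any with x , x∈xs , px ← find any with ys , xs↭ ← ∈⇒↭∷ x∈xs =
  inj₁ (x , ys , xs↭ , px)

++-interchange : (ws xs ys zs : List A) → (ws ++ xs) ++ (ys ++ zs) ↭ (ws ++ ys) ++ (xs ++ zs)
++-interchange {A = A} = interchange
  where open import Algebra.Properties.CommutativeSemigroup
               (CommutativeMonoid.commutativeSemigroup (Perm.++-commutativeMonoid {A = A}))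

-- Orienting a multigraph

module Orientation {C : Set} (_≟C_ : DecidableEquality C) where

  δ : C → C → ℕ
  δ c d = 𝟙 (c ≟C d)

  Chooses : C × C → C → Set
  Chooses (u , v) d = d ≡ u ⊎ d ≡ v

  degree : C → List (C × C) → ℕ
  degree c = ∑ λ (u , v) → δ c u + δ c v

  Pointwise-↭ : {es es′ : List (C × C)} {ds′ : List C} → es ↭ es′ → Pointwise Chooses es′ ds′ →
    ∃ λ ds → Pointwise Chooses es ds × ds ↭ ds′
  Pointwise-↭ refl         ps           = _ , ps , refl
  Pointwise-↭ (prep e p)   (c ∷ ps)     with ds , qs , r ← Pointwise-↭ p ps =
    _ ∷ ds , c ∷ qs , prep _ r
  Pointwise-↭ (swap e f p) (c ∷ d ∷ ps) with ds , qs , r ← Pointwise-↭ p ps =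
    _ ∷ _ ∷ ds , d ∷ c ∷ qs , swap _ _ r
  Pointwise-↭ (trans p q)  ps           with ds , qs , r ← Pointwise-↭ q ps
                                        with ds′ , qs′ , r′ ← Pointwise-↭ p qs =
    ds′ , qs′ , trans r′ r

  -- `ds` lists the head chosen for each edge. The inequality bounds each in-degree by half the
  -- degree rounded up, without dividing.
  Oriented : List (C × C) → Set
  Oriented es = ∃ λ ds → Pointwise Chooses es ds × ∀ c → 2 * ∑ (δ c) ds ≤ suc (degree c es)

  Oriented-↭ : {es es′ : List (C × C)} → es ↭ es′ → Oriented es′ → Oriented es
  Oriented-↭ p (ds , ps , bound) with ds′ , qs , r ← Pointwise-↭ p ps =
    ds′ , qs , λ c →
      subst₂ (λ m n → 2 * m ≤ suc n) (sym (∑-↭ (δ c) r)) (sym (∑-↭ _ p)) (bound c)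

  Ends : C × C → C → C → Set
  Ends e v w = e ≡ (v , w) ⊎ e ≡ (w , v)

  degree-ends : ∀ {e v w} es c → Ends e v w → degree c (e ∷ es) ≡ (δ c v + δ c w) + degree c es
  degree-ends es c (inj₁ refl) = refl
  degree-ends {v = v} {w} es c (inj₂ refl) = cong (_+ degree c es) (+-comm (δ c w) (δ c v))

  chooses-ends : ∀ {e v w d} → Ends e v w → Chooses (v , w) d → Chooses e d
  chooses-ends (inj₁ refl) ch        = ch
  chooses-ends (inj₂ refl) (inj₁ eq) = inj₂ eq
  chooses-ends (inj₂ refl) (inj₂ eq) = inj₁ eq

  -- Two edges (u , v) and (v , w) are replaced by a single edge (u , w): whichever way
  -- that edge is oriented, following it through v uses v exactly once.
  unsplit : ∀ {u w es} v e → Ends e v w →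
    Oriented ((u , w) ∷ es) → Oriented ((u , v) ∷ e ∷ es)
  unsplit {u} {w} {es} v e e≡ (d ∷ ds , ch ∷ chs , bound) = body ch
    where
    arith : ∀ x s u v w D → 2 * (x + s) ≤ suc ((u + w) + D) →
      2 * (x + (v + s)) ≤ suc ((u + v) + ((v + w) + D))
    arith x s u v w D le = begin
      2 * (x + (v + s))                  ≡⟨ e₁ x s v ⟩
      2 * v + 2 * (x + s)                ≤⟨ +-monoʳ-≤ (2 * v) le ⟩
      2 * v + suc ((u + w) + D)          ≡⟨ e₂ u v w D ⟩
      suc ((u + v) + ((v + w) + D))      ∎
      where
      open ≤-Reasoning
      e₁ : ∀ x s v → 2 * (x + (v + s)) ≡ 2 * v + 2 * (x + s)
      e₁ = solve-∀
      e₂ : ∀ u v w D → 2 * v + suc ((u + w) + D) ≡ suc ((u + v) + ((v + w) + D))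
      e₂ = solve-∀
    bound′ : ∀ c → 2 * (δ c d + (δ c v + ∑ (δ c) ds)) ≤ suc ((δ c u + δ c v) + degree c (e ∷ es))
    bound′ c rewrite degree-ends es c e≡ = arith (δ c d) (∑ (δ c) ds) (δ c u) (δ c v) (δ c w) (degree c es) (bound c)
    body : Chooses (u , w) d → Oriented ((u , v) ∷ e ∷ es)
    body (inj₁ d≡u) = d ∷ v ∷ ds , inj₁ d≡u ∷ chooses-ends e≡ (inj₁ refl) ∷ chs , bound′
    body (inj₂ d≡w) = v ∷ d ∷ ds , inj₂ refl ∷ chooses-ends e≡ (inj₂ d≡w) ∷ chs , λ c →
      subst (λ s → 2 * s ≤ suc ((δ c u + δ c v) + degree c (e ∷ es)))
        (exchange (δ c d) (δ c v) (∑ (δ c) ds)) (bound′ c)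
      where
      exchange : ∀ a b s → a + (b + s) ≡ b + (a + s)
      exchange = solve-∀

  -- Induction on the number of edges. A loop adds two to the degree and one to the in-degree of its
  -- vertex; an edge that shares its end `v` with another edge is merged with it into one edge.
  orient : ∀ n (es : List (C × C)) → length es ≤ n → Oriented es
  orient n [] _ = [] , [] , λ _ → z≤n
  orient (suc n) ((u , v) ∷ es) (s≤s len) with u ≟C v
  ... | yes refl with ds , chs , bound ← orient n es len =
    u ∷ ds , inj₁ refl ∷ chs , λ c → arith (δ c u) (∑ (δ c) ds) (degree c es) (bound c)
    where
    arith : ∀ x s D → 2 * s ≤ suc D → 2 * (x + s) ≤ suc ((x + x) + D)
    arith x s D le = begin
      2 * (x + s)         ≡⟨ e₃ x s ⟩
      (x + x) + 2 * s     ≤⟨ +-monoʳ-≤ (x + x) le ⟩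
      (x + x) + suc D     ≡⟨ +-suc (x + x) D ⟩
      suc ((x + x) + D)   ∎
      where
      open ≤-Reasoning
      e₃ : ∀ x s → 2 * (x + s) ≡ (x + x) + 2 * s
      e₃ = solve-∀
  ... | no u≢v with pick (λ (a , b) → (v ≟C a) ⊎-dec (v ≟C b)) {es}
  ... | inj₁ ((a , b) , es′ , es↭ , at) = Oriented-↭ (prep (u , v) es↭) (through at)
    where
    shorter : ∀ w → length ((u , w) ∷ es′) ≤ n
    shorter w = subst (_≤ n) (Perm.↭-length es↭) len
    through : v ≡ a ⊎ v ≡ b → Oriented ((u , v) ∷ (a , b) ∷ es′)
    through (inj₁ refl) = unsplit v _ (inj₁ refl) (orient n ((u , b) ∷ es′) (shorter b))
    through (inj₂ refl) = unsplit v _ (inj₂ refl) (orient n ((u , a) ∷ es′) (shorter a))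
  -- The edge is the only one at `v`, so pointing it there gives in-degree one at degree one, and no
  -- other in-degree grows.
  ... | inj₂ none with ds , chs , bound ← orient n es len =
    v ∷ ds , inj₂ refl ∷ chs , bound′
    where
    no-edge : ∀ {es} → All (λ (a , b) → ¬ (v ≡ a ⊎ v ≡ b)) es → degree v es ≡ 0
    no-edge [] = refl
    no-edge {(a , b) ∷ _} (¬at ∷ ¬ats)
      rewrite 𝟙-no (v ≟C a) (¬at ∘ inj₁) | 𝟙-no (v ≟C b) (¬at ∘ inj₂) = no-edge ¬ats
    half : ∀ s → 2 * s ≤ 1 → s ≡ 0
    half zero    _  = refl
    half (suc s) (s≤s le) with () ← m+n≤o⇒n≤o s le
    bound′ : ∀ c → 2 * (δ c v + ∑ (δ c) ds) ≤ suc ((δ c u + δ c v) + degree c es)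
    bound′ c with c ≟C v
    ... | no _ = ≤-trans (bound c) (s≤s (m≤n+m _ (δ c u + 0)))
    ... | yes refl
      rewrite half (∑ (δ v) ds) (subst (λ D → 2 * ∑ (δ v) ds ≤ suc D) (no-edge none) (bound v))
      = s≤s (≤-trans (m≤n+m 1 (δ v u)) (m≤m+n _ _))

-- Distributing rows over components

-- Parity absorbs the extra one. This makes rounding up harmless when the bound being halved is
-- even.
2*-cancel : ∀ {m n} → 2 * m ≤ suc (2 * n) → m ≤ n
2*-cancel {m} {n} le = ≮⇒≥ λ n<m → <-irrefl refl (<-≤-trans (s≤s le) (begin
  suc (suc (2 * n))   ≡⟨ *-suc 2 n ⟨
  2 * suc n           ≤⟨ *-monoʳ-≤ 2 n<m ⟩
  2 * m               ∎))
  where open ≤-Reasoning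

-- A new value either does not exceed the current index `length xs`, or raises it because all of
-- `xs` exceeds it too, or replaces a member of `xs`. Serving `xs` on a component then costs a row
-- in `ys` no more than the number of rows served.
h-index : (f : A → ℕ) (zs : List A) →
  ∃₂ λ xs ys → zs ↭ xs ++ ys × All (λ x → length xs ≤ f x) xs × All (λ y → f y ≤ length xs) ys
h-index f [] = [] , [] , refl , [] , []
h-index f (z ∷ zs) with h-index f zs
... | xs , ys , p , large , small with f z ≤? length xs
... | yes fz≤ = xs , z ∷ ys , trans (prep z p) (↭-sym (Perm.shift z xs ys)) , large , fz≤ ∷ small
... | no fz≰ with pick (λ x → f x ≤? length xs) {xs}
... | inj₂ larger =
  z ∷ xs , ys , prep z p , ≰⇒> fz≰ ∷ All.map ≰⇒> larger , All.map (λ le → m≤n⇒m≤1+n le) small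
... | inj₁ (x , xs′ , q , fx≤) =
  z ∷ xs′ , x ∷ ys ,
  trans (prep z (trans p (Perm.++⁺ʳ ys q))) (prep z (↭-sym (Perm.shift x xs′ ys))) ,
  subst (λ n → All (λ y → n ≤ f y) (z ∷ xs′)) len
    (≰⇒≥ fz≰ ∷ All.tail (Perm.All-resp-↭ q large)) ,
  subst (λ n → All (λ y → f y ≤ n) (x ∷ ys)) len (fx≤ ∷ small)
  where len = Perm.↭-length q

∑-positive : {P : A → Set} (P? : Decidable P) {xs : List A} → 1 ≤ ∑ (𝟙 ∘ P?) xs → ∃ λ x → x ∈ xs × P x
∑-positive P? {x ∷ xs} pos with P? x
... | yes px = x , here refl , px
... | no _ with y , y∈ , py ← ∑-positive P? pos = y , there y∈ , py

∑-two : {P : A → Set} (P? : Decidable P) {xs : List A} → Unique xs → 2 ≤ ∑ (𝟙 ∘ P?) xs →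
  ∃₂ λ u v → u ≢ v × u ∈ xs × v ∈ xs × P u × P v
∑-two P? {x ∷ xs} (x∉ ∷ uniq) two with P? x
... | no _ with u , v , u≢v , u∈ , v∈ , pu , pv ← ∑-two P? uniq two =
  u , v , u≢v , there u∈ , there v∈ , pu , pv
... | yes px with y , y∈ , py ← ∑-positive P? (s≤s⁻¹ two) =
  x , y , All.lookup x∉ y∈ , here refl , there y∈ , px , py

-- The truncated subtraction is genuine: if `xs` has a member, each `f x ∸ p` is positive, so `p`
-- lies below `f x`.
stacked : (f : A → ℕ) (p : ℕ) {xs : List A} →
  All (λ x → length xs ≤ f x ∸ p) xs → All (λ x → length xs + p ≤ f x) xs
stacked f p {[]}     _   = []
stacked f p {x ∷ xs} les = All.map (λ {y} → stack (f y) (length xs)) les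
  where
  stack : ∀ n m → suc m ≤ n ∸ p → suc m + p ≤ n
  stack n m le with ≤-total p n
  ... | inj₁ p≤n = m≤o∸n⇒m+n≤o (suc m) p≤n le
  ... | inj₂ n≤p with () ← subst (suc m ≤_) (m≤n⇒m∸n≡0 n≤p) le

stacked-≤ : {f : A → ℕ} {p t : ℕ} {xs : List A} → p ≤ t →
  All (λ x → length xs + p ≤ f x) xs → (∀ x → f x ≤ t) → length xs + p ≤ t
stacked-≤ {xs = []}    p≤t _        _   = p≤t
stacked-≤ {xs = x ∷ _} _   (le ∷ _) f≤t = ≤-trans le (f≤t x)

-- `a r c` stands for the number of vertices of row `r` on component `c`, and `t c` for the number
-- of rows that the hypothesis on cycles can serve there.
module Distribution {R C : Set} (_≟C_ : DecidableEquality C) (a : R → C → ℕ) (t : C → ℕ) where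
  open Orientation _≟C_

  -- A share `xs` of `m` rows meets what the hypothesis on cycles asks: `m` is within the capacity
  -- of the component, and each row has at least `m` vertices there.
  data Allotment : List C → List R → Set where
    []   : Allotment [] []
    cons : ∀ {c cs rs} xs ys → rs ↭ xs ++ ys → length xs ≤ t c →
           All (λ r → length xs ≤ a r c) xs → Allotment cs ys → Allotment (c ∷ cs) rs

  Allotment-↭ : ∀ {cs rs rs′} → rs ↭ rs′ → Allotment cs rs′ → Allotment cs rs
  Allotment-↭ p [] with refl ← Perm.↭-empty-inv p = []
  Allotment-↭ p (cons xs ys q le les al) = cons xs ys (trans p q) le les al

  Full : C → R → Set
  Full c r = t c < a r c

  full? : ∀ c → Decidable (Full c)
  full? c r = t c <? a r c

  capped : R → C → ℕ
  capped r c = a r c ⊓ t c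

  -- The pairs in os are rows already promised to a component on which they are full;
  -- the rows in gs are distributed greedily on top of them.
  complete : ∀ cs (gs : List R) (os : List (R × C)) →
    All (λ g → length gs + length os ≤ ∑ (capped g) cs) gs →
    All (λ (r , c) → Full c r) os → All (λ (_ , c) → c ∈ cs) os →
    (∀ {c} → c ∈ cs → ∑ (δ c ∘ proj₂) os ≤ t c) →
    Allotment cs (gs ++ map proj₁ os)
  complete [] [] [] _ _ _ _ = []
  complete [] (g ∷ gs) os (() ∷ _) _ _ _
  complete [] [] (o ∷ os) _ _ (() ∷ _) _
  complete (c ∷ cs) gs os enough full os⊆ room
    with separate (λ (_ , d) → c ≟C d) os
  -- The rows in `os₁` already occupy part of the share of `c`, so a row joining them needs that
  -- many vertices on top; hence the subtraction before taking the h-index.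
  ... | os₁ , os₂ , q , at , away with h-index (λ g → capped g c ∸ length os₁) gs
  ... | xs , ys , p , large , small =
    cons (xs ++ map proj₁ os₁) (ys ++ map proj₁ os₂)
      (trans (Perm.++⁺ p (trans (Perm.map⁺ proj₁ q) (↭-reflexive (List.map-++ proj₁ os₁ os₂))))
             (++-interchange xs ys (map proj₁ os₁) (map proj₁ os₂)))
      (subst (_≤ t c) (sym len) total)
      (subst (λ n → All (λ r → n ≤ a r c) (xs ++ map proj₁ os₁)) (sym len)
        (All.++⁺ (All.map (λ le → ≤-trans le (m⊓n≤m _ _)) large′)
             (All.map⁺ (All.zipWith (λ {(refl , f) → ≤-trans total (<⇒≤ f)}) (at , full₁)))))
      (complete cs ys os₂ enough′ full₂
        (All.zipWith (λ { (≢c , here refl) → contradiction refl ≢c ; (_ , there ∈cs) → ∈cs })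
          (away , proj₂ os⊆₁₂))
        room′)
    where
    full₁ = proj₁ (All.++⁻ os₁ (Perm.All-resp-↭ q full))
    full₂ = proj₂ (All.++⁻ os₁ (Perm.All-resp-↭ q full))
    os⊆₁₂ = All.++⁻ os₁ (Perm.All-resp-↭ q os⊆)
    len : length (xs ++ map proj₁ os₁) ≡ length xs + length os₁
    len rewrite List.length-++ xs {map proj₁ os₁} | List.length-map proj₁ os₁ = refl
    ∑-split : ∀ d → ∑ (δ d ∘ proj₂) os ≡ ∑ (δ d ∘ proj₂) os₁ + ∑ (δ d ∘ proj₂) os₂
    ∑-split d = ≡-trans (∑-↭ _ q) (∑-++ _ os₁ os₂)
    os₁≤t : length os₁ ≤ t c
    os₁≤t = begin
      length os₁             ≡⟨ ∑-one (All.map (λ {(_ , d)} → 𝟙-yes (c ≟C d)) at) ⟨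
      ∑ (δ c ∘ proj₂) os₁    ≤⟨ m≤m+n _ _ ⟩
      _                      ≡⟨ ∑-split c ⟨
      ∑ (δ c ∘ proj₂) os     ≤⟨ room (here refl) ⟩
      t c                    ∎ where open ≤-Reasoning
    large′ : All (λ r → length xs + length os₁ ≤ capped r c) xs
    large′ = stacked (λ g → capped g c) (length os₁) large
    total : length xs + length os₁ ≤ t c
    total = stacked-≤ os₁≤t large′ λ r → m⊓n≤n (a r c) (t c)
    room′ : ∀ {d} → d ∈ cs → ∑ (δ d ∘ proj₂) os₂ ≤ t d
    room′ {d} d∈ = ≤-trans (≤-trans (m≤n+m _ _) (≤-reflexive (sym (∑-split d)))) (room (there d∈))
    -- The share of `c` removes `length xs + length os₁` rows, and a row in `ys` has at most that
    -- much capped size on `c`, so the requirement survives on the other components.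
    enough′ : All (λ g → length ys + length os₂ ≤ ∑ (capped g) cs) ys
    enough′ = All.zipWith (λ {g} (big , le) → remainder g big le)
      (proj₂ (All.++⁻ xs (Perm.All-resp-↭ p enough)) , small)
      where
      regroup : ∀ x y o₁ o₂ → (x + o₁) + (y + o₂) ≡ (x + y) + (o₁ + o₂)
      regroup = solve-∀
      remainder : ∀ g → length gs + length os ≤ capped g c + ∑ (capped g) cs →
        capped g c ∸ length os₁ ≤ length xs → length ys + length os₂ ≤ ∑ (capped g) cs
      remainder g big le = +-cancelˡ-≤ (length xs + length os₁) _ _ (begin
        (length xs + length os₁) + (length ys + length os₂)
          ≡⟨ regroup (length xs) (length ys) (length os₁) (length os₂) ⟩
        (length xs + length ys) + (length os₁ + length os₂)
          ≡⟨ cong₂ _+_ (List.length-++ xs) (List.length-++ os₁) ⟨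
        length (xs ++ ys) + length (os₁ ++ os₂)
          ≡⟨ cong₂ _+_ (Perm.↭-length p) (Perm.↭-length q) ⟨
        length gs + length os
          ≤⟨ big ⟩
        capped g c + ∑ (capped g) cs
          ≤⟨ +-monoˡ-≤ _ (≤-trans (m≤n+m∸n _ (length os₁)) (+-monoʳ-≤ (length os₁) le)) ⟩
        (length os₁ + length xs) + ∑ (capped g) cs
          ≡⟨ cong (_+ ∑ (capped g) cs) (+-comm (length os₁) _) ⟩
        (length xs + length os₁) + ∑ (capped g) cs ∎)
        where open ≤-Reasoning

  -- A row whose capped sizes do not add up to the number of rows is full on two
  -- components. Reading such rows as edges, an orientation promises to each component
  -- at most half of the rows full on it.
  distribute : ∀ cs rs → Unique cs →
    All (λ r → ∀ c → c ∈ cs → a r c ≤ suc (t c)) rs →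
    (∀ {c} → c ∈ cs → ∑ (𝟙 ∘ full? c) rs ≤ 2 * t c) →
    All (λ r → length rs < ∑ (a r) cs) rs →
    Allotment cs rs
  distribute cs rs uniq bounded few enough
    with separate (λ r → length rs ≤? ∑ (capped r) cs) rs
  ... | gs , bs , p , good , bad =
    Allotment-↭ (trans p (Perm.++⁺ˡ gs (↭-reflexive (sym rows≡))))
      (complete cs gs os (All.map (subst (_≤ _) size) good) os-full os-in room)
    where
    TwoFull : R → C × C → Set
    TwoFull r (u , v) = u ≢ v × u ∈ cs × v ∈ cs × Full u r × Full v r

    bounded′ = proj₂ (All.++⁻ gs (Perm.All-resp-↭ p bounded))
    enough′ = proj₂ (All.++⁻ gs (Perm.All-resp-↭ p enough))

    -- Capping costs at most one vertex per component, and only where the row is full. The true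
    -- total exceeds `length rs` and the capped total falls short of it, so they differ by at least
    -- two.
    two-full : ∀ {r} → ¬ (length rs ≤ ∑ (capped r) cs) → (∀ c → c ∈ cs → a r c ≤ suc (t c)) →
      length rs < ∑ (a r) cs → ∃ (TwoFull r)
    two-full {r} ¬le bd lt =
      let u , v , rest = ∑-two (λ c → full? c r) uniq two in (u , v) , rest
      where
      split : ∀ c → a r c ≤ suc (t c) → a r c ≤ capped r c + 𝟙 (full? c r)
      split c le with full? c r
      ... | no ¬f rewrite 𝟙-no (full? c r) ¬f | m≤n⇒m⊓n≡m (≮⇒≥ ¬f) | +-identityʳ (a r c) = ≤-refl
      ... | yes f rewrite 𝟙-yes (full? c r) f | m≥n⇒m⊓n≡n (<⇒≤ f) | +-comm (t c) 1 = le
      two : 2 ≤ ∑ (λ c → 𝟙 (full? c r)) cs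
      two = +-cancelˡ-≤ (∑ (capped r) cs) _ _ (begin
        ∑ (capped r) cs + 2                            ≡⟨ +-comm (∑ (capped r) cs) 2 ⟩
        suc (suc (∑ (capped r) cs))                    ≤⟨ s≤s (≰⇒> ¬le) ⟩
        suc (length rs)                                ≤⟨ lt ⟩
        ∑ (a r) cs                                     ≤⟨ ∑-mono (All.tabulate λ {c} c∈ → split c (bd c c∈)) ⟩
        ∑ (λ c → capped r c + 𝟙 (full? c r)) cs        ≡⟨ ∑-+ (capped r) _ cs ⟩
        ∑ (capped r) cs + ∑ (λ c → 𝟙 (full? c r)) cs   ∎)
        where open ≤-Reasoning

    edged : All (λ r → ∃ (TwoFull r)) bs
    edged = All.zipWith (λ (¬le , bd , lt) → two-full ¬le bd lt) (bad , All.zip (bounded′ , enough′))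

    edges : ∀ {rs} → All (λ r → ∃ (TwoFull r)) rs → List (C × C)
    edges = All.reduce proj₁

    Promised : List R → List C → Set
    Promised rs ds = ∃ λ os → map proj₁ os ≡ rs × map proj₂ os ≡ ds ×
      All (λ (r , c) → Full c r) os × All (λ (_ , c) → c ∈ cs) os

    promise : ∀ {rs ds} (es : All (λ r → ∃ (TwoFull r)) rs) →
      Pointwise Chooses (edges es) ds → Promised rs ds
    promise [] [] = [] , refl , refl , [] , []
    promise ((_ , _ , u∈ , v∈ , fu , fv) ∷ es) (ch ∷ chs)
      with os , refl , refl , fs , ins ← promise es chs | ch
    ... | inj₁ refl = (_ , _) ∷ os , refl , refl , fu ∷ fs , u∈ ∷ ins
    ... | inj₂ refl = (_ , _) ∷ os , refl , refl , fv ∷ fs , v∈ ∷ ins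

    -- The two ends of an edge are distinct components, so a row adds at most one to the degree at
    -- `c`, and only if it is full on `c`.
    degree≤ : ∀ c {rs} (es : All (λ r → ∃ (TwoFull r)) rs) → degree c (edges es) ≤ ∑ (𝟙 ∘ full? c) rs
    degree≤ c [] = z≤n
    degree≤ c {r ∷ _} (((u , v) , u≢v , _ , _ , fu , fv) ∷ es) = +-mono-≤ once (degree≤ c es)
      where
      once : δ c u + δ c v ≤ 𝟙 (full? c r)
      once with c ≟C u | c ≟C v
      ... | yes refl | yes refl = contradiction refl u≢v
      ... | yes refl | no _     = ≤-reflexive (sym (𝟙-yes (full? c r) fu))
      ... | no _     | yes refl = ≤-reflexive (sym (𝟙-yes (full? c r) fv))
      ... | no _     | no _     = z≤n

    oriented = orient _ (edges edged) ≤-refl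
    promised = promise edged (proj₁ (proj₂ oriented))
    os = proj₁ promised
    rows≡ = proj₁ (proj₂ promised)
    comps≡ = proj₁ (proj₂ (proj₂ promised))
    os-full = proj₁ (proj₂ (proj₂ (proj₂ promised)))
    os-in = proj₂ (proj₂ (proj₂ (proj₂ promised)))

    size : length rs ≡ length gs + length os
    size = begin
      length rs                        ≡⟨ Perm.↭-length p ⟩
      length (gs ++ bs)                ≡⟨ List.length-++ gs ⟩
      length gs + length bs            ≡⟨ cong (λ bs → length gs + length bs) rows≡ ⟨
      length gs + length (map proj₁ os) ≡⟨ cong (length gs +_) (List.length-map proj₁ os) ⟩
      length gs + length os            ∎ where open ≡-Reasoning

    room : ∀ {c} → c ∈ cs → ∑ (δ c ∘ proj₂) os ≤ t c
    -- Rounding up half of the degree costs nothing, since the bound `2 * t c` on the degree is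
    -- even.
    room {c} c∈ = 2*-cancel (begin
      2 * ∑ (δ c ∘ proj₂) os              ≡⟨ cong (λ ds → 2 * sum ds) (List.map-∘ os) ⟩
      2 * ∑ (δ c) (map proj₂ os)          ≡⟨ cong (λ ds → 2 * ∑ (δ c) ds) comps≡ ⟩
      2 * ∑ (δ c) (proj₁ oriented)        ≤⟨ proj₂ (proj₂ oriented) c ⟩
      suc (degree c (edges edged))        ≤⟨ s≤s (degree≤ c edged) ⟩
      suc (∑ (𝟙 ∘ full? c) bs)            ≤⟨ s≤s (m≤n+m _ (∑ (𝟙 ∘ full? c) gs)) ⟩
      suc (∑ (𝟙 ∘ full? c) gs + ∑ (𝟙 ∘ full? c) bs) ≡⟨ cong suc (∑-++ _ gs bs) ⟨
      suc (∑ (𝟙 ∘ full? c) (gs ++ bs))    ≡⟨ cong suc (∑-↭ _ p) ⟨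
      suc (∑ (𝟙 ∘ full? c) rs)            ≤⟨ s≤s (few c∈) ⟩
      suc (2 * t c)                       ∎)
      where
      open ≤-Reasoning

-- Lists without repetition

AllPairs-resp-↭ : {R : A → A → Set} → (∀ {x y} → R x y → R y x) →
  {xs ys : List A} → xs ↭ ys → AllPairs R xs → AllPairs R ys
AllPairs-resp-↭ s refl ps = ps
AllPairs-resp-↭ s (prep x p) (r ∷ ps) = Perm.All-resp-↭ p r ∷ AllPairs-resp-↭ s p ps
AllPairs-resp-↭ s (swap x y p) ((r ∷ rs) ∷ (rs′ ∷ ps)) =
  (s r ∷ Perm.All-resp-↭ p rs′) ∷ (Perm.All-resp-↭ p rs ∷ AllPairs-resp-↭ s p ps)
AllPairs-resp-↭ s (trans p q) ps = AllPairs-resp-↭ s q (AllPairs-resp-↭ s p ps)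

Unique-resp-↭ : {xs ys : List A} → xs ↭ ys → Unique xs → Unique ys
Unique-resp-↭ = AllPairs-resp-↭ (_∘ sym)

Unique-++⁻ : (xs : List A) {ys : List A} → Unique (xs ++ ys) → Unique xs × Unique ys × Disjoint xs ys
Unique-++⁻ [] u = [] , u , λ ()
Unique-++⁻ (x ∷ xs) {ys} (x∉ ∷ u) with ux , uy , dis ← Unique-++⁻ xs u =
  proj₁ (All.++⁻ xs x∉) ∷ ux , uy ,
  λ { (here refl , v∈ys) → All.lookup (proj₂ (All.++⁻ xs x∉)) v∈ys refl ; (there v∈ , v∈ys) → dis (v∈ , v∈ys) }

∷-⊆-drop : {x : A} {xs ys ys′ : List A} → All (x ≢_) xs → ys ↭ x ∷ ys′ → x ∷ xs ⊆ ys → xs ⊆ ys′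
∷-⊆-drop x∉ p sub z∈ with Perm.∈-resp-↭ p (sub (there z∈))
... | here refl = contradiction refl (All.lookup x∉ z∈)
... | there z∈′ = z∈′

unique-⊆⇒↭ : {xs ys : List A} → Unique xs → xs ⊆ ys → ∃ λ zs → ys ↭ xs ++ zs
unique-⊆⇒↭ {xs = []} {ys} _ _ = ys , refl
unique-⊆⇒↭ {xs = x ∷ xs} (x∉ ∷ u) sub with ys′ , p ← ∈⇒↭∷ (sub (here refl))
  with zs , q ← unique-⊆⇒↭ u (∷-⊆-drop x∉ p sub) = zs , trans p (prep x q)

unique-⊆⇒length≤ : {xs ys : List A} → Unique xs → xs ⊆ ys → length xs ≤ length ys
unique-⊆⇒length≤ {xs = xs} u sub with zs , p ← unique-⊆⇒↭ u sub
  rewrite Perm.↭-length p | List.length-++ xs {zs} = m≤m+n _ _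

tabulate-injective-↭ : ∀ {m} {f : Fin m → Fin m} → Injective f → tabulate f ↭ allFin m
tabulate-injective-↭ {m} {f} inj
  with unique-⊆⇒↭ (Unique.tabulate⁺ (inj _ _)) (λ {i} _ → ∈-allFin {n = m} i)
... | []     , p = ↭-sym (trans p (↭-reflexive (List.++-identityʳ _)))
... | z ∷ zs , p = contradiction m≡ (m≢1+m+n m)
  where
  open ≡-Reasoning
  m≡ : m ≡ suc m + length zs
  m≡ = begin
    m                                        ≡⟨ List.length-tabulate {n = m} (λ i → i) ⟨
    length (allFin m)                        ≡⟨ Perm.↭-length p ⟩
    length (tabulate f ++ z ∷ zs)            ≡⟨ List.length-++ (tabulate f) ⟩
    length (tabulate f) + suc (length zs)    ≡⟨ cong (_+ suc (length zs)) (List.length-tabulate f) ⟩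
    m + suc (length zs)                      ≡⟨ +-suc m (length zs) ⟩
    suc m + length zs                        ∎

lookup-injective : {xs : List A} → Unique xs → ∀ i j → lookup xs i ≡ lookup xs j → i ≡ j
lookup-injective (x∉ ∷ u) zero    zero    _  = refl
lookup-injective (x∉ ∷ u) zero    (suc j) eq = contradiction eq (All.lookup x∉ (∈-lookup j))
lookup-injective (x∉ ∷ u) (suc i) zero    eq = contradiction (sym eq) (All.lookup x∉ (∈-lookup i))
lookup-injective (x∉ ∷ u) (suc i) (suc j) eq = cong suc (lookup-injective u i j eq)

AllPairs-lookup : {R : A → A → Set} → (∀ {x y} → R x y → R y x) → {xs : List A} → AllPairs R xs →
  ∀ i j → i ≢ j → R (lookup xs i) (lookup xs j)
AllPairs-lookup s (r ∷ ps) zero    zero    i≢j = contradiction refl i≢j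
AllPairs-lookup s (r ∷ ps) zero    (suc j) i≢j = All.lookup r (∈-lookup j)
AllPairs-lookup s (r ∷ ps) (suc i) zero    i≢j = s (All.lookup r (∈-lookup i))
AllPairs-lookup s (r ∷ ps) (suc i) (suc j) i≢j = AllPairs-lookup s ps i j (i≢j ∘ cong suc)

-- Needed because the hypothesis on cycles takes independent sets of size exactly `m`, whereas a row
-- may have more vertices on a cycle.
shrink : ∀ {n} (S : Subset n) m → m ≤ ∣ S ∣ → ∃ λ S′ → S′ Subset.⊆ S × ∣ S′ ∣ ≡ m
shrink {n} S zero _ = Subset.⊥ , (λ x∈ → contradiction x∈ SubsetP.∉⊥) , SubsetP.∣⊥∣≡0 n
shrink (true Vec.∷ S) (suc m) (s≤s le) with S′ , sub , eq ← shrink S m le =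
  inside Vec.∷ S′ , SubsetP.s⊆s sub , cong suc eq
shrink (false Vec.∷ S) (suc m) le with S′ , sub , eq ← shrink S (suc m) le =
  outside Vec.∷ S′ , SubsetP.s⊆s sub , eq

-- Neighbours on the standard cycle

Next : ∀ {ℓ} → Fin ℓ → Fin ℓ → Set
Next {ℓ} i j = suc (toℕ i) ≡ toℕ j ⊎ (suc (toℕ i) ≡ ℓ × toℕ j ≡ 0)

cycNext⇒Next : ∀ {ℓ} (i j : Fin ℓ) → T (cycNext ℓ i j) → Next i j
cycNext⇒Next {ℓ} i j t = Sum.map (≡ᵇ⇒≡ _ _)
  (λ t′ → let p , q = Equivalence.to T-∧ t′ in ≡ᵇ⇒≡ _ _ p , ≡ᵇ⇒≡ _ _ q)
  (Equivalence.to (T-∨ {suc (toℕ i) ≡ᵇ toℕ j}) t)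

Next⇒cycNext : ∀ {ℓ} (i j : Fin ℓ) → Next i j → T (cycNext ℓ i j)
Next⇒cycNext {ℓ} i j n = Equivalence.from (T-∨ {suc (toℕ i) ≡ᵇ toℕ j}) (Sum.map (≡⇒≡ᵇ _ _)
  (λ (p , q) → Equivalence.from T-∧ (≡⇒≡ᵇ _ _ p , ≡⇒≡ᵇ _ _ q)) n)

next : ∀ {ℓ} (i : Fin ℓ) → ∃ λ j → Next i j
next {suc ℓ} i with suc (toℕ i) <? suc ℓ
... | yes lt = fromℕ< lt , inj₁ (sym (Fin.toℕ-fromℕ< lt))
... | no ¬lt = zero , inj₂ (≤-antisym (Fin.toℕ<n i) (≮⇒≥ ¬lt) , refl)

prev : ∀ {ℓ} (i : Fin ℓ) → ∃ λ j → Next j i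
prev {suc ℓ} zero    = fromℕ ℓ , inj₂ (cong suc (Fin.toℕ-fromℕ ℓ) , refl)
prev {suc ℓ} (suc i) = inject₁ i , inj₁ (cong suc (Fin.toℕ-inject₁ i))

-- Following each other both ways is possible only for `ℓ` equal to one or two. From length three
-- on, the successor and the predecessor of a position differ.
Next-asym : ∀ {ℓ} {i j : Fin ℓ} → 3 ≤ ℓ → Next i j → ¬ Next j i
Next-asym _ (inj₁ p) (inj₁ q) = <-asym (≤-reflexive p) (≤-reflexive q)
Next-asym 3≤ (inj₁ p) (inj₂ (q , r)) =
  <-irrefl (≡-trans (cong suc (≡-trans (cong suc (sym r)) p)) q) 3≤
Next-asym 3≤ (inj₂ (p , q)) (inj₁ r) =
  <-irrefl (≡-trans (cong suc (≡-trans (cong suc (sym q)) r)) p) 3≤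
Next-asym 3≤ (inj₂ (p , q)) (inj₂ (r , s)) =
  <-irrefl (≡-trans (cong suc (sym q)) r) (≤-trans (s≤s (s≤s z≤n)) 3≤)

-- Counting in lists and subsets

⌊n/2⌋-bounds : ∀ n → 2 * ⌊ n /2⌋ ≤ n × n ≤ suc (2 * ⌊ n /2⌋)
⌊n/2⌋-bounds 0 = z≤n , z≤n
⌊n/2⌋-bounds 1 = z≤n , s≤s z≤n
⌊n/2⌋-bounds (suc (suc n)) with lo , hi ← ⌊n/2⌋-bounds n
  rewrite +-suc ⌊ n /2⌋ (⌊ n /2⌋ + 0) = s≤s (s≤s lo) , s≤s (s≤s hi)

∑-tight : {f : A → ℕ} {xs : List A} → All (λ x → f x ≤ 1) xs → length xs ≤ ∑ f xs → All (λ x → f x ≡ 1) xs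
∑-tight [] _ = []
∑-tight {f = f} {x ∷ xs} (fx≤ ∷ fxs≤) le =
  ≤-antisym fx≤ (+-cancelʳ-≤ (length xs) 1 (f x) (≤-trans le (+-monoʳ-≤ (f x) rest≤))) ∷
  ∑-tight fxs≤ (s≤s⁻¹ (≤-trans le (+-monoˡ-≤ _ fx≤)))
  where
  rest≤ : ∑ f xs ≤ length xs
  rest≤ = ≤-trans (∑-mono {g = λ _ → 1} fxs≤) (≤-reflexive (∑-one {f = λ _ → 1} (All.universal (λ _ → refl) xs)))

𝟙T : Bool → ℕ
𝟙T b = 𝟙 (T? b)

𝟙T-injective : ∀ {a b} → 𝟙T a ≡ 𝟙T b → a ≡ b
𝟙T-injective {true}  {true}  _ = refl
𝟙T-injective {false} {false} _ = refl

𝟙T-exclusive : ∀ a b → (T a → ¬ T b) → 𝟙T a + 𝟙T b ≤ 1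
𝟙T-exclusive true  true  ex = contradiction _ (ex _)
𝟙T-exclusive true  false _  = s≤s z≤n
𝟙T-exclusive false true  _  = s≤s z≤n
𝟙T-exclusive false false _  = z≤n

∣tabulate∣ : (f : A → Bool) (xs : List A) → ∣ Vec.tabulate (f ∘ lookup xs) ∣ ≡ ∑ (𝟙T ∘ f) xs
∣tabulate∣ f []       = refl
∣tabulate∣ f (x ∷ xs) with f x
... | true  = cong suc (∣tabulate∣ f xs)
... | false = ∣tabulate∣ f xs

∈-tabulate⁻ : ∀ {n} {f : Fin n → Bool} {i} → i Subset.∈ Vec.tabulate f → T (f i)
∈-tabulate⁻ {f = f} {i} i∈ =
  Equivalence.from T-≡ (≡-trans (sym (Vec.lookup∘tabulate f i)) (Vec.[]=⇒lookup i∈))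

∑-all : {P : A → Set} (P? : Decidable P) {xs : List A} → All P xs → ∑ (𝟙 ∘ P?) xs ≡ length xs
∑-all P? ps = ∑-one (All.map (𝟙-yes (P? _)) ps)

∑-none : {P : A → Set} (P? : Decidable P) {xs : List A} → All (¬_ ∘ P) xs → ∑ (𝟙 ∘ P?) xs ≡ 0
∑-none P? [] = refl
∑-none P? {x ∷ _} (¬p ∷ ¬ps) rewrite 𝟙-no (P? x) ¬p = ∑-none P? ¬ps

∑-concat : (f : A → ℕ) (xss : List (List A)) → ∑ f (concat xss) ≡ ∑ (∑ f) xss
∑-concat f []         = refl
∑-concat f (xs ∷ xss) = ≡-trans (∑-++ f xs (concat xss)) (cong (∑ f xs +_) (∑-concat f xss))

∑-tabulate : ∀ {n} {f : A → ℕ} (S : Subset n) (g : Fin n → A) →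
  (∀ i → f (g i) ≡ 𝟙T (Vec.lookup S i)) → ∑ f (tabulate g) ≡ ∣ S ∣
∑-tabulate Vec.[]            g eq = refl
∑-tabulate (true  Vec.∷ S) g eq = cong₂ _+_ (eq zero) (∑-tabulate S (g ∘ suc) (eq ∘ suc))
∑-tabulate (false Vec.∷ S) g eq = cong₂ _+_ (eq zero) (∑-tabulate S (g ∘ suc) (eq ∘ suc))

take-↭ : ∀ n (xs ys : List A) → n ≤ length xs →
  length (take n xs) ≡ n × xs ++ ys ↭ take n xs ++ (drop n xs ++ ys)
take-↭ n xs ys n≤ =
  ≡-trans (List.length-take n xs) (m≤n⇒m⊓n≡m n≤) ,
  ↭-reflexive (≡-trans (cong (_++ ys) (sym (List.take++drop≡id n xs))) (List.++-assoc (take n xs) _ _))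

-- Pigeonhole with two colours. In use, `P` is fullness on a cycle and `f` tests membership of one
-- vertex of it, which tells the two alternating sets apart.
monochromatic : {P : A → Set} (P? : Decidable P) (f : A → Bool) (xs : List A) (t : ℕ) →
  2 * t < ∑ (𝟙 ∘ P?) xs → ∃₂ λ ys zs → xs ↭ ys ++ zs × length ys ≡ suc t × All P ys ×
  ∃ λ b → All (λ y → f y ≡ b) ys
monochromatic P? f xs t lt with separate P? xs
... | ps , ns , p , yes-P , no-P with separate (λ y → f y Bool.≟ true) ps
... | ts , us , q , f-true , f-false with suc t ≤? length ts
... | yes t<ts = let len , r = take-↭ (suc t) ts us t<ts in
  take (suc t) ts , (drop (suc t) ts ++ us) ++ ns ,
  trans p (trans (Perm.++⁺ʳ ns (trans q r)) (↭-reflexive (List.++-assoc (take (suc t) ts) _ ns))) ,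
  len , All.take⁺ (suc t) (proj₁ (All.++⁻ ts (Perm.All-resp-↭ q yes-P))) , true , All.take⁺ (suc t) f-true
... | no ¬t<ts = let len , r = take-↭ (suc t) us ts t<us in
  take (suc t) us , (drop (suc t) us ++ ts) ++ ns ,
  trans p (trans (Perm.++⁺ʳ ns (trans q (trans (Perm.++-comm ts us) r)))
    (↭-reflexive (List.++-assoc (take (suc t) us) _ ns))) ,
  len , All.take⁺ (suc t) (proj₂ (All.++⁻ ts (Perm.All-resp-↭ q yes-P))) ,
  false , All.take⁺ (suc t) (All.map Bool.¬-not f-false)
  where
  t<us : t < length us
  t<us = +-cancelˡ-< t _ _ (begin-strict
    t + t                             ≡⟨ cong (t +_) (+-identityʳ t) ⟨
    2 * t                             <⟨ lt ⟩
    ∑ (𝟙 ∘ P?) xs                     ≡⟨ ∑-↭ _ p ⟩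
    ∑ (𝟙 ∘ P?) (ps ++ ns)             ≡⟨ ∑-++ _ ps ns ⟩
    ∑ (𝟙 ∘ P?) ps + ∑ (𝟙 ∘ P?) ns     ≡⟨ cong₂ _+_ (∑-all P? yes-P) (∑-none P? no-P) ⟩
    length ps + 0                     ≡⟨ +-identityʳ _ ⟩
    length ps                         ≡⟨ Perm.↭-length q ⟩
    length (ts ++ us)                 ≡⟨ List.length-++ ts ⟩
    length ts + length us             ≤⟨ +-monoˡ-≤ _ (s≤s⁻¹ (≰⇒> ¬t<ts)) ⟩
    t + length us                     ∎)
    where open ≤-Reasoning

-- Cycles in a graph of maximum degree two

module Cycles (G : Graph) (adj-sym : ∀ u v → Adj G u v → Adj G v u) (adj-irrefl : ∀ u → ¬ Adj G u u)
              (deg≤2 : MaxDegreeAtMost2 G) where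

  Vertex : Set
  Vertex = Fin (V G)

  open import Data.List.Membership.DecPropositional (Fin._≟_ {V G}) using (_∈?_)

  -- The end point `z` is kept apart from the list so that the recursion remembers where the walk
  -- must arrive; for a closed walk, `z` is its first vertex.
  steps : Vertex → List Vertex → List (Vertex × Vertex)
  steps z []           = []
  steps z (x ∷ [])     = (x , z) ∷ []
  steps z (x ∷ y ∷ xs) = (x , y) ∷ steps z (y ∷ xs)

  Walk : Vertex → List Vertex → Set
  Walk z xs = All (uncurry (Adj G)) (steps z xs)

  data IsCycle : List Vertex → Set where
    cycle : ∀ {x xs} → 3 ≤ length (x ∷ xs) → Unique (x ∷ xs) → Walk x (x ∷ xs) → IsCycle (x ∷ xs)

  walk-step : ∀ {z} xs → Walk z xs → (i j : Fin (length xs)) → suc (toℕ i) ≡ toℕ j →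
    Adj G (lookup xs i) (lookup xs j)
  walk-step (x ∷ [])     _        zero    zero          ()
  walk-step (x ∷ y ∷ xs) (a ∷ _)  zero    (suc zero)    _  = a
  walk-step (x ∷ y ∷ xs) (_ ∷ as) (suc i) (suc j)       eq = walk-step (y ∷ xs) as i j (suc-injective eq)

  walk-end : ∀ {z} xs → Walk z xs → (i : Fin (length xs)) → suc (toℕ i) ≡ length xs → Adj G (lookup xs i) z
  walk-end (x ∷ [])     (a ∷ _)  zero    _  = a
  walk-end (x ∷ y ∷ xs) (_ ∷ as) (suc i) eq = walk-end (y ∷ xs) as i (suc-injective eq)

  cycle-3≤ : ∀ {c} → IsCycle c → 3 ≤ length c
  cycle-3≤ (cycle 3≤ _ _) = 3≤

  cycle-unique : ∀ {c} → IsCycle c → Unique c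
  cycle-unique (cycle _ uniq _) = uniq

  Next⇒Adj : ∀ {c} → IsCycle c → ∀ i j → Next i j → Adj G (lookup c i) (lookup c j)
  Next⇒Adj (cycle _ _ w) i j    (inj₁ eq)       = walk-step _ w i j eq
  Next⇒Adj (cycle _ _ w) i zero (inj₂ (eq , _)) = walk-end _ w i eq

  module _ {c : List Vertex} (cyc : IsCycle c) where
    -- The successor and predecessor on the cycle are already two distinct neighbours, so by the
    -- degree bound there is no third. Hence a cycle is a whole connected component and has no
    -- chords.
    neighbours : ∀ i w → Adj G (lookup c i) w → ∃ λ k → lookup c k ≡ w × (Next i k ⊎ Next k i)
    neighbours i w iw with next i | prev i
    ... | j , n | k , p with lookup c j Fin.≟ w | lookup c k Fin.≟ w
    ... | yes eq | _      = j , eq , inj₁ n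
    ... | no _   | yes eq = k , eq , inj₂ p
    ... | no j≢w | no k≢w = ⊥-elim (deg≤2 (lookup c i) (lookup c j) (lookup c k) w
      (Next⇒Adj cyc i j n) (adj-sym _ _ (Next⇒Adj cyc k i p)) iw
      (λ eq → Next-asym (cycle-3≤ cyc) n (subst (λ x → Next x i) (sym (lookup-injective (cycle-unique cyc) j k eq)) p)) j≢w k≢w)

    closed : ∀ {v w} → v ∈ c → Adj G v w → w ∈ c
    closed {v} {w} v∈ vw
      with k , refl , _ ← neighbours (index v∈) w (subst (λ v → Adj G v w) (lookup-index v∈) vw) = ∈-lookup k

    Adj-cycle⇒ : ∀ i j → Adj (Cycle (length c)) i j → Adj G (lookup c i) (lookup c j)
    Adj-cycle⇒ i j a with Equivalence.to (T-∨ {cycNext (length c) i j}) a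
    ... | inj₁ n = Next⇒Adj cyc i j (cycNext⇒Next i j n)
    ... | inj₂ n = adj-sym _ _ (Next⇒Adj cyc j i (cycNext⇒Next j i n))

    Adj-cycle⇐ : ∀ i j → Adj G (lookup c i) (lookup c j) → Adj (Cycle (length c)) i j
    Adj-cycle⇐ i j a with k , eq , n ← neighbours i _ a with refl ← lookup-injective (cycle-unique cyc) k j eq =
      Equivalence.from (T-∨ {cycNext (length c) i j})
        (Sum.map (Next⇒cycNext i j) (Next⇒cycNext j i) n)

  -- Extracting the cycles of a 2-regular vertex set

  Branching : List Vertex → Vertex → Set
  Branching W v = ∃₂ λ a b → a ∈ W × b ∈ W × Adj G v a × Adj G v b × a ≢ b

  branching? : ∀ W → Decidable (Branching W)
  branching? W v with any? (λ a → any? (λ b → T? (adj G v a) ×-dec T? (adj G v b) ×-dec ¬? (a Fin.≟ b)) W) W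
  ... | yes p with a , a∈ , q ← find p with b , b∈ , r ← find q = yes (a , b , a∈ , b∈ , r)
  ... | no ¬p = no λ (a , b , a∈ , b∈ , r) → ¬p (lose a∈ (lose b∈ r))

  data Path : List Vertex → Set where
    end : ∀ x → Path (x ∷ [])
    _∷_ : ∀ {x y xs} → Adj G x y → Path (y ∷ xs) → Path (x ∷ y ∷ xs)

  -- Every inner vertex of the path already has its two neighbours on the path, so a
  -- neighbour d of y on the path can only be its last vertex.
  close : ∀ {u w d y xs} → Adj G u w → Path (w ∷ xs) → u ≢ y → Unique (u ∷ w ∷ xs) → y ∉ w ∷ xs →
    d ∈ w ∷ xs → Adj G y d → Walk y (w ∷ xs)
  close uw (end _) u≢y _ y∉ (here refl) yd = adj-sym _ _ yd ∷ []
  close {u} {w} {y = y} uw (_∷_ {y = v} wv p) u≢y ((_ ∷ u∉) ∷ _) y∉ (here refl) yd =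
    ⊥-elim (deg≤2 w u v y (adj-sym _ _ uw) wv (adj-sym _ _ yd)
      (All.lookup u∉ (here refl)) u≢y (λ { refl → y∉ (there (here refl)) }))
  close uw (wv ∷ p) u≢y (_ ∷ uniq) y∉ (there d∈) yd =
    wv ∷ close wv p (λ { refl → y∉ (here refl) }) uniq (y∉ ∘ there) d∈ yd

  close-path : ∀ {x y d xs} → Path (x ∷ xs) → Unique (x ∷ xs) → y ∉ x ∷ xs → d ∈ xs → Adj G y d →
    Walk y (x ∷ xs)
  close-path (xw ∷ p) uniq y∉ d∈ yd = xw ∷ close xw p (y∉ ∘ here ∘ sym) uniq (y∉ ∘ there) d∈ yd

  other-neighbour : ∀ {W y} x → Branching W y → ∃ λ d → d ∈ W × Adj G y d × d ≢ x
  other-neighbour x (a , b , a∈ , b∈ , ya , yb , a≢b) with a Fin.≟ x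
  ... | no a≢x   = a , a∈ , ya , a≢x
  ... | yes refl = b , b∈ , yb , a≢b ∘ sym

  fresh : ∀ {x} {xs : List Vertex} → x ∉ xs → All (x ≢_) xs
  fresh x∉ = All.tabulate λ { y∈ refl → x∉ y∈ }

  -- The path grows at its front. A second neighbour `d` of the head `y` is either new and is put in
  -- front, or lies on the path and closes a cycle. The fuel suffices because the path stays inside
  -- `W` without repetition.
  extend : ∀ W → (∀ {v} → v ∈ W → Branching W v) → ∀ n y x xs → length W ≤ n + length xs →
    Path (y ∷ x ∷ xs) → Unique (y ∷ x ∷ xs) → y ∷ x ∷ xs ⊆ W → ∃ λ c → IsCycle c × c ⊆ W
  extend W reg n y x xs fuel (yx ∷ p) uniq sub
    with other-neighbour x (reg (sub (here refl)))
  ... | d , d∈W , yd , d≢x with d ∈? (y ∷ x ∷ xs)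
  ... | yes (here refl) = contradiction yd (adj-irrefl y)
  ... | yes (there (here refl)) = contradiction refl d≢x
  extend W reg n y x (z ∷ xs) fuel (yx ∷ p) uniq@(y∉ ∷ uniq′) sub
    | d , d∈W , yd , d≢x | yes (there (there d∈)) =
    _ , cycle (s≤s (s≤s (s≤s z≤n))) uniq
          (yx ∷ close-path p uniq′ (λ y∈ → All.lookup y∉ y∈ refl) d∈ yd) , sub
  extend W reg zero y x xs fuel (yx ∷ p) uniq sub | d , d∈W , yd , d≢x | no d∉ =
    contradiction (unique-⊆⇒length≤ uniq sub) (<⇒≱ (s≤s (≤-trans fuel (n≤1+n _))))
  extend W reg (suc n) y x xs fuel (yx ∷ p) uniq sub | d , d∈W , yd , d≢x | no d∉ =
    extend W reg n d y (x ∷ xs) (subst (length W ≤_) (sym (+-suc n _)) fuel)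
      (adj-sym _ _ yd ∷ yx ∷ p) (fresh d∉ ∷ uniq) λ { (here refl) → d∈W ; (there v∈) → sub v∈ }

-- The hypothesis on cycles, and transversals of rows

CycleHypothesis : Set
CycleHypothesis = ∀ (m ℓ : ℕ) → 1 ≤ m → 2 * m + 1 ≤ ℓ → fG≡ (Cycle ℓ) m m m

-- `χ r` is the indicator function of row `r`. Rows and vertices are discarded by passing to
-- sublists, so the graph and the family stay fixed during the induction.
module Rainbow
  (G : Graph) (adj-sym : ∀ u v → Adj G u v → Adj G v u) (adj-irrefl : ∀ u → ¬ Adj G u u)
  (deg≤2 : MaxDegreeAtMost2 G)
  {R : Set} (χ : R → Fin (V G) → Bool)
  (independent : ∀ r u v → T (χ r u) → T (χ r v) → ¬ Adj G u v)
  where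

  open Cycles G adj-sym adj-irrefl deg≤2

  size : R → List Vertex → ℕ
  size r = ∑ (𝟙T ∘ χ r)

  Apart : Vertex → Vertex → Set
  Apart u v = u ≢ v × ¬ Adj G u v

  record Transversal (W : List Vertex) (rs : List R) : Set where
    constructor transversal
    field
      picks : List (R × Vertex)
      rows  : map proj₁ picks ↭ rs
      valid : All (λ (r , v) → T (χ r v) × v ∈ W) picks
      apart : AllPairs (Apart on proj₂) picks

  none : ∀ {W} → Transversal W []
  none = transversal [] refl [] []

  single : ∀ {r v} → T (χ r v) → Transversal (v ∷ []) (r ∷ [])
  single χrv = transversal (_ ∷ []) refl ((χrv , here refl) ∷ []) ([] ∷ [])

  widen : ∀ {W W′ rs rs′} → W ⊆ W′ → rs′ ↭ rs → Transversal W rs → Transversal W′ rs′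
  widen sub p (transversal ps rows valid apart) =
    transversal ps (trans rows (↭-sym p)) (All.map (λ (χrv , v∈) → χrv , sub v∈) valid) apart

  join : ∀ {W₁ W₂ rs₁ rs₂} → (∀ {u v} → u ∈ W₁ → v ∈ W₂ → Apart u v) →
    Transversal W₁ rs₁ → Transversal W₂ rs₂ → Transversal (W₁ ++ W₂) (rs₁ ++ rs₂)
  join {W₁} apart (transversal ps₁ rows₁ valid₁ apart₁) (transversal ps₂ rows₂ valid₂ apart₂) = transversal
    (ps₁ ++ ps₂)
    (trans (↭-reflexive (List.map-++ proj₁ ps₁ ps₂)) (Perm.++⁺ rows₁ rows₂))
    (All.++⁺ (All.map (λ (χrv , v∈) → χrv , ∈-++⁺ˡ v∈) valid₁)
             (All.map (λ (χrv , v∈) → χrv , ∈-++⁺ʳ W₁ v∈) valid₂))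
    (AllPairs.++⁺ apart₁ apart₂ (All.map (λ (_ , u∈) → All.map (λ (_ , v∈) → apart u∈ v∈) valid₂) valid₁))

  fan : ∀ xs vs → length xs ≤ length vs → AllPairs Apart vs →
    (∀ {r v} → r ∈ xs → v ∈ vs → T (χ r v)) → Transversal vs xs
  fan []       vs       _        _        _   = none
  fan (r ∷ xs) (v ∷ vs) (s≤s le) (a ∷ as) χrv =
    join (λ { (here refl) w∈ → All.lookup a w∈ })
      (single (χrv (here refl) (here refl)))
      (fan xs vs le as (λ r∈ v∈ → χrv (there r∈) (there v∈)))

  -- Independent sets on a cycle

  -- For nonempty `c`, the largest `m` with `2 * m + 1 ≤ length c`, hence the range of the
  -- hypothesis on cycles.
  capacity : List Vertex → ℕ
  capacity c = ⌊ pred (length c) /2⌋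

  length-steps : ∀ z xs → length (steps z xs) ≡ length xs
  length-steps z []           = refl
  length-steps z (x ∷ [])     = refl
  length-steps z (x ∷ y ∷ xs) = cong suc (length-steps z (y ∷ xs))

  -- Every vertex lies in two consecutive pairs, except that the start `x` lacks one and the end `z`
  -- has one extra. For a closed walk these corrections cancel.
  ∑-steps : ∀ (f : Vertex → ℕ) z x xs →
    ∑ (λ (u , v) → f u + f v) (steps z (x ∷ xs)) + f x ≡ 2 * ∑ f (x ∷ xs) + f z
  ∑-steps f z x [] = lemma (f x) (f z)
    where
    lemma : ∀ a b → ((a + b) + 0) + a ≡ 2 * (a + 0) + b
    lemma = solve-∀
  ∑-steps f z x (y ∷ xs) = begin
    (f x + f y + S) + f x                  ≡⟨ regroup₁ (f x) (f y) S ⟩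
    (f x + f x) + (S + f y)                ≡⟨ cong (f x + f x +_) (∑-steps f z y xs) ⟩
    (f x + f x) + (2 * ∑ f (y ∷ xs) + f z) ≡⟨ regroup₂ (f x) (∑ f (y ∷ xs)) (f z) ⟩
    2 * (f x + ∑ f (y ∷ xs)) + f z         ∎
    where
    open ≡-Reasoning
    S = ∑ (λ (u , v) → f u + f v) (steps z (y ∷ xs))
    regroup₁ : ∀ a b s → (a + b + s) + a ≡ (a + a) + (s + b)
    regroup₁ = solve-∀
    regroup₂ : ∀ a s b → (a + a) + (2 * s + b) ≡ 2 * (a + s) + b
    regroup₂ = solve-∀

  weight : R → Vertex × Vertex → ℕ
  weight r (u , v) = 𝟙T (χ r u) + 𝟙T (χ r v)

  weight≤1 : ∀ r {z xs} → Walk z xs → All (λ e → weight r e ≤ 1) (steps z xs)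
  weight≤1 r = All.map λ {(u , v)} uv → 𝟙T-exclusive (χ r u) (χ r v) λ χu χv → independent r u v χu χv uv

  ∑-weight : ∀ r x xs → ∑ (weight r) (steps x (x ∷ xs)) ≡ 2 * size r (x ∷ xs)
  ∑-weight r x xs = +-cancelʳ-≡ _ _ _ (∑-steps (𝟙T ∘ χ r) x x xs)

  -- Double counting: each vertex is on two edges of the cycle, and each edge has at most one end in
  -- an independent set.
  2*size≤ : ∀ {c} → IsCycle c → ∀ r → 2 * size r c ≤ length c
  2*size≤ (cycle {x} {xs} _ _ w) r = begin
    2 * size r (x ∷ xs)                    ≡⟨ ∑-weight r x xs ⟨
    ∑ (weight r) (steps x (x ∷ xs))        ≤⟨ ∑-mono {g = λ _ → 1} (weight≤1 r w) ⟩
    ∑ (λ _ → 1) (steps x (x ∷ xs))         ≡⟨ ∑-one {f = λ _ → 1} (All.universal (λ _ → refl) (steps x (x ∷ xs))) ⟩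
    length (steps x (x ∷ xs))              ≡⟨ length-steps x (x ∷ xs) ⟩
    length (x ∷ xs)                        ∎
    where open ≤-Reasoning

  size≤ : ∀ {c} → IsCycle c → ∀ r → size r c ≤ suc (capacity c)
  size≤ {x ∷ xs} cyc r = 2*-cancel (begin
    2 * size r (x ∷ xs)                  ≤⟨ 2*size≤ cyc r ⟩
    suc (length xs)                      ≤⟨ s≤s (proj₂ (⌊n/2⌋-bounds (length xs))) ⟩
    suc (suc (2 * ⌊ length xs /2⌋))      ≤⟨ n≤1+n _ ⟩
    suc (suc (suc (2 * ⌊ length xs /2⌋))) ≡⟨ cong suc (*-suc 2 ⌊ length xs /2⌋) ⟨
    suc (2 * suc ⌊ length xs /2⌋)        ∎)
    where open ≤-Reasoning

  -- With the opposite inequality this is an equality: a cycle carrying a full row has even length,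
  -- and the row meets every edge.
  full⇒2*size≥ : ∀ {c} → IsCycle c → ∀ r → capacity c < size r c → length c ≤ 2 * size r c
  full⇒2*size≥ {x ∷ xs} _ r lt = begin
    suc (length xs)                      ≤⟨ s≤s (proj₂ (⌊n/2⌋-bounds (length xs))) ⟩
    suc (suc (2 * ⌊ length xs /2⌋))      ≡⟨ *-suc 2 ⌊ length xs /2⌋ ⟨
    2 * suc ⌊ length xs /2⌋              ≤⟨ *-monoʳ-≤ 2 lt ⟩
    2 * size r (x ∷ xs)                  ∎
    where open ≤-Reasoning

  -- When each edge has exactly one end in either row, the value at one vertex forces the value at
  -- the next, so agreement at `x` spreads along the walk.
  alternating-agree : ∀ {r s} z x xs →
    All (λ e → weight r e ≡ 1) (steps z (x ∷ xs)) → All (λ e → weight s e ≡ 1) (steps z (x ∷ xs)) →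
    χ r x ≡ χ s x → All (λ v → χ r v ≡ χ s v) (x ∷ xs)
  alternating-agree z x []       _        _        eq = eq ∷ []
  alternating-agree {r} {s} z x (y ∷ xs) (p ∷ ps) (q ∷ qs) eq = eq ∷ alternating-agree z y xs ps qs
    (𝟙T-injective (+-cancelˡ-≡ (𝟙T (χ r x)) _ _
      (≡-trans p (≡-trans (sym q) (cong (λ b → 𝟙T b + 𝟙T (χ s y)) (sym eq))))))

  full-agree : ∀ {x xs r s} → IsCycle (x ∷ xs) →
    capacity (x ∷ xs) < size r (x ∷ xs) → capacity (x ∷ xs) < size s (x ∷ xs) →
    χ r x ≡ χ s x → All (λ v → χ r v ≡ χ s v) (x ∷ xs)
  full-agree {x} {xs} cyc@(cycle _ _ w) fr fs eq =
    alternating-agree x x xs (alternating fr) (alternating fs) eq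
    where
    alternating : ∀ {r} → capacity (x ∷ xs) < size r (x ∷ xs) → All (λ e → weight r e ≡ 1) (steps x (x ∷ xs))
    alternating {r} full = ∑-tight (weight≤1 r w) (subst₂ _≤_
      (sym (length-steps x (x ∷ xs))) (sym (∑-weight r x xs)) (full⇒2*size≥ cyc r full))

  -- The rows coincide on the cycle, so the vertices of one of them can be handed out in any order.
  -- This reaches one row beyond what the hypothesis on cycles can serve.
  full-cycle : ∀ {x xs b} → IsCycle (x ∷ xs) → ∀ rs → length rs ≤ suc (capacity (x ∷ xs)) →
    All (λ r → capacity (x ∷ xs) < size r (x ∷ xs)) rs → All (λ r → χ r x ≡ b) rs →
    Transversal (x ∷ xs) rs
  full-cycle _ [] _ _ _ = none
  full-cycle {x} {xs} cyc rs@(r ∷ _) len full@(f ∷ _) same@(eq ∷ _)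
    with separate (T? ∘ χ r) (x ∷ xs)
  ... | vs , ws , p , sel , off = widen (λ v∈ → Perm.∈-resp-↭ (↭-sym p) (∈-++⁺ˡ v∈)) refl
    (fan rs vs enough (AllPairs-apart vs sel (proj₁ (Unique-++⁻ vs (Unique-resp-↭ p (cycle-unique cyc))))) χ-vs)
    where
    AllPairs-apart : ∀ vs → All (T ∘ χ r) vs → Unique vs → AllPairs Apart vs
    AllPairs-apart [] _ _ = []
    AllPairs-apart (v ∷ vs) (χv ∷ χvs) (v∉ ∷ u) =
      All.zipWith (λ (≢ , χw) → ≢ , independent r _ _ χv χw) (v∉ , χvs) ∷ AllPairs-apart vs χvs u
    enough : length rs ≤ length vs
    enough = begin
      length rs                          ≤⟨ len ⟩
      suc (capacity (x ∷ xs))            ≤⟨ f ⟩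
      size r (x ∷ xs)                    ≡⟨ ∑-↭ _ p ⟩
      size r (vs ++ ws)                  ≡⟨ ∑-++ _ vs ws ⟩
      size r vs + size r ws              ≡⟨ cong₂ _+_ (∑-all (T? ∘ χ r) sel) (∑-none (T? ∘ χ r) off) ⟩
      length vs + 0                      ≡⟨ +-identityʳ _ ⟩
      length vs                          ∎
      where open ≤-Reasoning
    χ-vs : ∀ {s v} → s ∈ rs → v ∈ vs → T (χ s v)
    χ-vs s∈ v∈ = subst T
      (All.lookup (full-agree cyc f (All.lookup full s∈) (≡-trans eq (sym (All.lookup same s∈))))
        (Perm.∈-resp-↭ (↭-sym p) (∈-++⁺ˡ v∈)))
      (All.lookup sel v∈)

  -- Disjoint cycles and closed neighbourhoods

  Disjoint-sym : ∀ {xs ys : List Vertex} → Disjoint xs ys → Disjoint ys xs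
  Disjoint-sym dis (y∈ , x∈) = dis (x∈ , y∈)

  length-rest : ∀ {c W W′ n} → IsCycle c → W ↭ c ++ W′ → length W ≤ suc n → length W′ ≤ n
  length-rest {c} {W} {W′} {n} cyc p len = s≤s⁻¹ (begin
    suc (length W′)          ≤⟨ +-monoˡ-≤ (length W′) (≤-trans (s≤s z≤n) (cycle-3≤ cyc)) ⟩
    length c + length W′     ≡⟨ List.length-++ c ⟨
    length (c ++ W′)         ≡⟨ Perm.↭-length p ⟨
    length W                 ≤⟨ len ⟩
    suc n                    ∎)
    where open ≤-Reasoning

  -- A cycle is closed under adjacency, so a vertex outside it loses no neighbour when the cycle is
  -- removed.
  branching-rest : ∀ {c W W′} → IsCycle c → W ↭ c ++ W′ → Disjoint c W′ →
    (∀ {v} → v ∈ W → Branching W v) → ∀ {v} → v ∈ W′ → Branching W′ v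
  branching-rest {c} {W} {W′} cyc p dis branching {v} v∈
    with a , b , a∈ , b∈ , va , vb , a≢b ← branching (Perm.∈-resp-↭ (↭-sym p) (∈-++⁺ʳ c v∈))
    = a , b , stays a∈ va , stays b∈ vb , va , vb , a≢b
    where
    stays : ∀ {a} → a ∈ W → Adj G v a → a ∈ W′
    stays a∈ va with ∈-++⁻ c (Perm.∈-resp-↭ p a∈)
    ... | inj₁ a∈c  = ⊥-elim (dis (closed cyc a∈c (adj-sym _ _ va) , v∈))
    ... | inj₂ a∈W′ = a∈W′

  decompose : ∀ n W → length W ≤ n → Unique W → (∀ {v} → v ∈ W → Branching W v) →
    ∃ λ cs → W ↭ concat cs × All IsCycle cs × AllPairs Disjoint cs
  decompose _ [] _ _ _ = [] , refl , [] , []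
  decompose (suc n) W@(w ∷ _) len uniq branching
    with a , _ , a∈ , _ , wa , _ ← branching (here refl)
    with c , cyc , c⊆ ← extend W branching (length W) a w [] (m≤m+n _ 0) (adj-sym _ _ wa ∷ end w)
           (((λ { refl → adj-irrefl _ wa }) ∷ []) ∷ [] ∷ [])
           (λ { (here refl) → a∈ ; (there (here refl)) → here refl })
    with W′ , p ← unique-⊆⇒↭ (cycle-unique cyc) c⊆
    with _ , uniq′ , dis ← Unique-++⁻ c (Unique-resp-↭ p uniq)
    with cs , q , cycs , diss ← decompose n W′ (length-rest cyc p len) uniq′ (branching-rest cyc p dis branching)
    = c ∷ cs , trans p (Perm.++⁺ˡ c q) , cyc ∷ cycs ,
      All.tabulate (λ {d} d∈ (v∈c , v∈d) →
        dis (v∈c , Perm.∈-resp-↭ (↭-sym q) (∈-concat⁺ (lose d∈ v∈d)))) ∷ diss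

  cycles-unique : ∀ {cs} → All IsCycle cs → AllPairs Disjoint cs → Unique cs
  cycles-unique [] [] = []
  cycles-unique (cycle _ _ _ ∷ cycs) (dis ∷ diss) =
    All.map (λ { d refl → d (here refl , here refl) }) dis ∷ cycles-unique cycs diss

  cycle-apart : ∀ {c W u v} → IsCycle c → Disjoint c W → u ∈ c → v ∈ W → Apart u v
  cycle-apart cyc dis u∈ v∈ = (λ { refl → dis (u∈ , v∈) }) , λ uv → dis (closed cyc u∈ uv , v∈)

  Near : Vertex → Vertex → Set
  Near v w = w ≡ v ⊎ Adj G v w

  near? : ∀ v → Decidable (Near v)
  near? v w = (w Fin.≟ v) ⊎-dec T? (adj G v w)

  -- Two distinct members of `near` are either `v` and a neighbour, hence adjacent, or two
  -- neighbours of `v` in `W`, which `leaf` rules out.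
  simplicial-size≤1 : ∀ {W v near} r → ¬ Branching W v → near ⊆ W → Unique near → All (Near v) near → size r near ≤ 1
  simplicial-size≤1 {v = v} r leaf sub uniq nears = ≮⇒≥ λ two →
    let a , b , a≢b , a∈ , b∈ , χa , χb = ∑-two (T? ∘ χ r) uniq two
    in clash a≢b (sub a∈) (sub b∈) χa χb (All.lookup nears a∈) (All.lookup nears b∈)
    where
    clash : ∀ {a b} → a ≢ b → a ∈ _ → b ∈ _ → T (χ r a) → T (χ r b) → Near v a → Near v b → ⊥
    clash a≢b _ _ _ _ (inj₁ refl) (inj₁ refl) = a≢b refl
    clash _ _ _ χa χb (inj₁ refl) (inj₂ vb) = independent r _ _ χa χb vb
    clash _ _ _ χa χb (inj₂ va) (inj₁ refl) = independent r _ _ χb χa va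
    clash a≢b a∈ b∈ _ _ (inj₂ va) (inj₂ vb) = leaf (_ , _ , a∈ , b∈ , va , vb , a≢b)

  -- Rainbow sets from the hypothesis on cycles

  module _ (hyp : CycleHypothesis) where

    open Distribution (List.≡-dec (Fin._≟_ {V G})) size capacity

    -- The traces of the rows on `c`, cut down to size `m`, become independent sets of the standard
    -- cycle. A rainbow `m`-set out of `m` rows uses each of them once.
    rainbow-cycle : ∀ {c} → IsCycle c → ∀ rs → length rs ≤ capacity c →
      All (λ r → length rs ≤ size r c) rs → Transversal c rs
    rainbow-cycle _ [] _ _ = none
    rainbow-cycle {c@(c₀ ∷ c′)} cyc rs@(_ ∷ _) len large =
      transversal (tabulate pick′) rows (All.tabulate⁺ {f = pick′} λ j → valid j , ∈-lookup (x j))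
        (AllPairs.tabulate⁺ {f = pick′} λ {i} {j} i≢j →
          (λ eq → i≢j (x-inj i j (lookup-injective (cycle-unique cyc) _ _ eq))) ,
          x-indep i j ∘ Adj-cycle⇐ cyc (x i) (x j))
      where
      m = length rs
      short : 2 * m + 1 ≤ length c
      short = begin
        2 * m + 1                         ≡⟨ +-comm (2 * m) 1 ⟩
        suc (2 * m)                       ≤⟨ s≤s (*-monoʳ-≤ 2 len) ⟩
        suc (2 * capacity c)              ≤⟨ s≤s (proj₁ (⌊n/2⌋-bounds (length c′))) ⟩
        length c                          ∎
        where open ≤-Reasoning
      trace : ∀ i → ∃ λ S → S Subset.⊆ Vec.tabulate (χ (lookup rs i) ∘ lookup c) × ∣ S ∣ ≡ m
      trace i = shrink _ m
        (subst (m ≤_) (sym (∣tabulate∣ (χ (lookup rs i)) c)) (All.lookup large (∈-lookup i)))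
      on-row : ∀ {i j} → j Subset.∈ proj₁ (trace i) → T (χ (lookup rs i) (lookup c j))
      on-row {i} j∈ = ∈-tabulate⁻ {f = χ (lookup rs i) ∘ lookup c} (proj₁ (proj₂ (trace i)) j∈)
      solution : RainbowIndepSet (Cycle (length c)) m (proj₁ ∘ trace) m
      solution = proj₁ (hyp m (length c) (s≤s z≤n) short) (proj₁ ∘ trace) λ i →
        (λ u v u∈ v∈ a → independent (lookup rs i) _ _ (on-row u∈) (on-row v∈) (Adj-cycle⇒ cyc u v a)) ,
        proj₂ (proj₂ (trace i))
      x = proj₁ solution
      row = proj₁ (proj₂ solution)
      x-inj = proj₁ (proj₂ (proj₂ solution))
      row-inj = proj₁ (proj₂ (proj₂ (proj₂ solution)))
      x-indep = proj₂ (proj₂ (proj₂ (proj₂ (proj₂ solution))))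
      pick′ : Fin m → R × Vertex
      pick′ j = lookup rs (row j) , lookup c (x j)
      valid : ∀ j → T (χ (lookup rs (row j)) (lookup c (x j)))
      valid j = on-row (proj₁ (proj₂ (proj₂ (proj₂ (proj₂ solution)))) j)
      rows : map proj₁ (tabulate pick′) ↭ rs
      rows = begin
        map proj₁ (tabulate pick′)          ≡⟨ List.map-tabulate pick′ proj₁ ⟩
        tabulate (lookup rs ∘ row)          ≡⟨ List.map-tabulate row (lookup rs) ⟨
        map (lookup rs) (tabulate row)      ↭⟨ Perm.map⁺ (lookup rs) (tabulate-injective-↭ row-inj) ⟩
        map (lookup rs) (allFin m)          ≡⟨ List.map-tabulate (λ i → i) (lookup rs) ⟩
        tabulate (lookup rs)                ≡⟨ List.tabulate-lookup rs ⟩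
        rs                                  ∎
        where open Data.List.Relation.Binary.Permutation.Propositional.PermutationReasoning

    assemble : ∀ {cs rs} → All IsCycle cs → AllPairs Disjoint cs → Allotment cs rs → Transversal (concat cs) rs
    assemble [] [] [] = none
    assemble (cyc ∷ cycs) (dis ∷ diss) (cons xs ys p le les al) =
      widen (λ v∈ → v∈) p (join (cycle-apart cyc (Disjoint.concat⁺ʳ dis))
        (rainbow-cycle cyc xs le les) (assemble cycs diss al))

    rainbow-cycles : ∀ n cs rs → length cs ≤ n → All IsCycle cs → AllPairs Disjoint cs →
      All (λ r → length rs < ∑ (size r) cs) rs → Transversal (concat cs) rs
    rainbow-cycles n cs rs len cycs diss enough
      with pick (λ c → 2 * capacity c <? ∑ (𝟙 ∘ full? c) rs) {cs}
    ... | inj₂ few = assemble cycs diss (distribute cs rs (cycles-unique cycs diss)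
      (All.universal (λ r c c∈ → size≤ (All.lookup cycs c∈) r) rs)
      (λ c∈ → ≮⇒≥ (All.lookup few c∈)) enough)
    rainbow-cycles zero [] rs _ _ _ _ | inj₁ (c , cs′ , p , _) = contradiction (↭-sym p) Perm.¬x∷xs↭[]
    rainbow-cycles (suc n) cs rs len cycs diss enough | inj₁ (c , cs′ , p , crowded)
      with Perm.All-resp-↭ p cycs | AllPairs-resp-↭ Disjoint-sym p diss
    ... | cyc@(cycle {x} {xs} _ _ _) ∷ cycs′ | dis ∷ diss′
      with ys , zs , q , size-ys , full , _ , same ← monochromatic (full? c) (λ r → χ r x) rs (capacity c) crowded
      = widen (∈-concat⁺ ∘ Perm.Any-resp-↭ (↭-sym p) ∘ ∈-concat⁻ (c ∷ cs′)) q
          (join (cycle-apart cyc (Disjoint.concat⁺ʳ dis))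
            (full-cycle cyc ys (≤-reflexive size-ys) full same)
            (rainbow-cycles n cs′ zs (s≤s⁻¹ (subst (_≤ suc n) (Perm.↭-length p) len)) cycs′ diss′
              (All.map (λ {r} lt → +-cancelˡ-≤ (length ys) _ _ (remaining r lt))
                (proj₂ (All.++⁻ ys (Perm.All-resp-↭ q enough))))))
      where
      -- The crowded cycle serves `suc (capacity c)` rows and costs each remaining row at most as
      -- many vertices, so the surplus of one vertex persists.
      remaining : ∀ r → length rs < ∑ (size r) cs → length ys + suc (length zs) ≤ length ys + ∑ (size r) cs′
      remaining r lt = begin
        length ys + suc (length zs)        ≡⟨ +-suc (length ys) (length zs) ⟩
        suc (length ys + length zs)        ≡⟨ cong suc (List.length-++ ys) ⟨
        suc (length (ys ++ zs))            ≡⟨ cong suc (Perm.↭-length q) ⟨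
        suc (length rs)                    ≤⟨ lt ⟩
        ∑ (size r) cs                      ≡⟨ ∑-↭ (size r) p ⟩
        size r c + ∑ (size r) cs′          ≤⟨ +-monoˡ-≤ _ (size≤ cyc r) ⟩
        suc (capacity c) + ∑ (size r) cs′  ≡⟨ cong (_+ ∑ (size r) cs′) size-ys ⟨
        length ys + ∑ (size r) cs′         ∎
        where open ≤-Reasoning

    -- A vertex with at most one neighbour in W has a clique as its closed neighbourhood, so
    -- choosing it costs every other row at most one vertex; otherwise W is 2-regular.
    rainbow : ∀ n W rs → length W ≤ n → Unique W → All (λ r → length rs < size r W) rs → Transversal W rs
    rainbow n W rs len uniq enough with pick (¬? ∘ branching? W) {W}
    ... | inj₂ branching
      with cs , p , cycs , diss ← decompose n W len uniq
             (λ v∈ → decidable-stable (branching? W _) (All.lookup branching v∈))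
      = widen (Perm.∈-resp-↭ (↭-sym p)) refl (rainbow-cycles (length cs) cs rs ≤-refl cycs diss
          (All.map (λ {r} → subst (length rs <_) (≡-trans (∑-↭ _ p) (∑-concat _ cs))) enough))
    rainbow zero [] rs _ _ _ | inj₁ (v , W′ , p , _) = contradiction (↭-sym p) Perm.¬x∷xs↭[]
    rainbow (suc n) W rs len uniq enough | inj₁ (v , W′ , p , leaf) with pick (λ r → T? (χ r v)) {rs}
    -- No row contains `v`, so deleting it from `W` leaves every size unchanged.
    ... | inj₂ avoid = widen (Perm.∈-resp-↭ (↭-sym p) ∘ there) refl
      (rainbow n W′ rs (s≤s⁻¹ (subst (_≤ suc n) (Perm.↭-length p) len))
        (AllPairs.tail (Unique-resp-↭ p uniq))
        (All.zipWith (λ {r} (lt , ¬χ) → subst (length rs <_)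
          (≡-trans (∑-↭ _ p) (cong (_+ size r W′) (𝟙-no (T? (χ r v)) ¬χ))) lt) (enough , avoid)))
    ... | inj₁ (r , rs′ , q , χrv) with separate (near? v) W
    ... | near , far , s , nears , fars = widen W-covers q
      (join (λ { (here refl) w∈ → All.lookup fars w∈ ∘ inj₁ ∘ sym , All.lookup fars w∈ ∘ inj₂ })
        (single χrv)
        (rainbow n far rs′ shorter (proj₁ (proj₂ uniqs))
          (All.map (λ {t} → remaining t) (All.tail (Perm.All-resp-↭ q enough)))))
      where
      uniqs = Unique-++⁻ near (Unique-resp-↭ s uniq)
      v∈W : v ∈ W
      v∈W = Perm.∈-resp-↭ (↭-sym p) (here refl)
      W-covers : v ∷ far ⊆ W
      W-covers (here refl) = v∈W
      W-covers (there w∈)  = Perm.∈-resp-↭ (↭-sym s) (∈-++⁺ʳ near w∈)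
      1≤near : 1 ≤ length near
      1≤near with ∈-++⁻ near (Perm.∈-resp-↭ s v∈W)
      ... | inj₁ v∈near = unique-⊆⇒length≤ ([] ∷ []) λ { (here refl) → v∈near }
      ... | inj₂ v∈far  = contradiction (inj₁ refl) (All.lookup fars v∈far)
      shorter : length far ≤ n
      shorter = s≤s⁻¹ (begin
        suc (length far)             ≤⟨ +-monoˡ-≤ _ 1≤near ⟩
        length near + length far     ≡⟨ List.length-++ near ⟨
        length (near ++ far)         ≡⟨ Perm.↭-length s ⟨
        length W                     ≤⟨ len ⟩
        suc n                        ∎)
        where open ≤-Reasoning
      remaining : ∀ t → length rs < size t W → length rs′ < size t far
      remaining t lt = s≤s⁻¹ (begin
        suc (suc (length rs′))       ≡⟨ cong suc (Perm.↭-length q) ⟨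
        suc (length rs)              ≤⟨ lt ⟩
        size t W                     ≡⟨ ∑-↭ _ s ⟩
        size t (near ++ far)         ≡⟨ ∑-++ _ near far ⟩
        size t near + size t far     ≤⟨ +-monoˡ-≤ _ (simplicial-size≤1 t leaf
                                          (Perm.∈-resp-↭ (↭-sym s) ∘ ∈-++⁺ˡ) (proj₁ uniqs) nears) ⟩
        suc (size t far)             ∎)
        where open ≤-Reasoning

-- From transversals to the value of `fG≡`

picks⇒RainbowIndepSet : (G : Graph) → IsSimple G → ∀ {k m} (F : Fin k → Subset (V G))
  (ps : List (Fin k × Fin (V G))) → length ps ≡ m → Unique (map proj₁ ps) →
  All (λ (i , v) → v Subset.∈ F i) ps →
  AllPairs (λ (_ , u) (_ , v) → u ≢ v × ¬ Adj G u v) ps → RainbowIndepSet G k F m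
picks⇒RainbowIndepSet G (adj-sym , adj-irrefl) F ps refl uniq valid apart =
  proj₂ ∘ lookup ps , proj₁ ∘ lookup ps ,
  (λ a b eq → decidable-stable (a Fin.≟ b) λ a≢b → proj₁ (apart-at a b a≢b) eq) ,
  (λ a b eq → decidable-stable (a Fin.≟ b) λ a≢b →
    AllPairs-lookup {R = λ p q → proj₁ p ≢ proj₁ q} (_∘ sym) (AllPairs.map⁻ uniq) a b a≢b eq) ,
  (λ j → All.lookup valid (∈-lookup j)) ,
  -- Nonadjacency is also demanded at equal indices, where it is irreflexivity.
  λ i j → case i Fin.≟ j of λ where
    (yes refl) → adj-irrefl _
    (no i≢j)   → proj₂ (apart-at i j i≢j)
  where
  apart-at = AllPairs-lookup {R = λ (_ , u) (_ , v) → u ≢ v × ¬ Adj G u v}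
    (λ (u≢v , ¬uv) → u≢v ∘ sym , ¬uv ∘ adj-sym _ _) apart

-- Apply `rainbow` to all vertices and all `k` rows: the size `suc k` of each row gives the surplus
-- of one that it needs.
rainbow-property : CycleHypothesis → ∀ G → IsSimple G → MaxDegreeAtMost2 G →
  ∀ k → HasRainbowProperty G (suc k) k k
rainbow-property hyp G simple@(adj-sym , adj-irrefl) deg≤2 k F indep =
  picks⇒RainbowIndepSet G simple F picks
    (≡-trans (sym (List.length-map proj₁ picks)) (≡-trans (Perm.↭-length rows) (List.length-tabulate {n = k} (λ i → i))))
    (Unique-resp-↭ (↭-sym rows) (Unique.allFin⁺ k))
    (All.map (λ {(i , v)} (χ , _) → member i v χ) valid) apart
  where
  member : ∀ i v → T (Vec.lookup (F i) v) → v Subset.∈ F i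
  member i v χ = Vec.lookup⇒[]= v (F i) (Equivalence.to T-≡ χ)
  open Rainbow G adj-sym adj-irrefl deg≤2 (λ i v → Vec.lookup (F i) v)
    (λ i u v χu χv → proj₁ (indep i) u v (member i u χu) (member i v χv))
  vertices = allFin (V G)
  size≡ : ∀ i → size i vertices ≡ suc k
  size≡ i = ≡-trans (∑-tabulate (F i) (λ v → v) (λ _ → refl)) (proj₂ (indep i))
  open Transversal (rainbow hyp (length vertices) vertices (allFin k) ≤-refl (Unique.allFin⁺ (V G))
    (All.universal (λ i → ≤-reflexive (≡-trans (cong suc (List.length-tabulate {n = k} (λ i → i))) (sym (size≡ i)))) (allFin k)))

theorem1p6 : (∀ (m ℓ : ℕ) → 1 ≤ m → 2 * m + 1 ≤ ℓ → fG≡ (Cycle ℓ) m m m) →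
    ∀ (n : ℕ) (G : Graph) → 1 ≤ n → IsSimple G → MaxDegreeAtMost2 G → CeAtMost4 G →
    Σ (Subset (V G)) (IndepNSet G n) →
    fG≡ G n (n ∸ 1) (n ∸ 1)
theorem1p6 hyp (suc k) G _ simple deg≤2 _ (S , indep) =
  rainbow-property hyp G simple deg≤2 k ,
  -- With `j` rows all equal to `S`, a rainbow set of size `k` would inject `k` indices into fewer.
  λ j j<k property → let _ , _ , _ , c-inj , _ = property (λ _ → S) (λ _ → indep) in
    <⇒≱ j<k (Fin.injective⇒≤ (c-inj _ _))
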